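{- Let $J_0$ be the $38$-vertex graph consisting of four pairwise disjoint cliques $C_1,C_2,C_3,C_4\cong K_9$ and two further vertices $u,v$, where consecutive cliques $C_i,C_{i+1}$ ($1\le i\le 3$) are joined completely, there are no edges between nonconsecutive cliques, $u$ is adjacent to exactly the vertices of $C_1$, and $v$ is adjacent to exactly the vertices of $C_4$ (so $uv$ is not an edge). Let $J_1=J_0+uv$. Then \[ \mathcal E_4^+(J_1)-\mathcal E_4^+(J_0)<-\frac{1281106782111}{500000000000}<0 . \]
   Context: For a finite simple graph $G$ with adjacency eigenvalues $\lambda_i(G)$ (the eigenvalues of its adjacency matrix, counted with multiplicity), the positive $4$-energy is \[ \mathcal E_4^+(G)=\sum_{\lambda_i(G)>0}\lambda_i(G)^4 . \] $J_0+uv$ denotes the graph obtained from $J_0$ by adding the edge $uv$. -}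

module Defs where

open import Algebra.Bundles.Raw using (RawRing)
import Algebra.Definitions.RawSemiring as RawSemiringDefs
open import Data.Bool.Base using (Bool; true; false; _∧_; _∨_; not; if_then_else_)
open import Data.Bool.Properties using (∨-comm)
open import Data.Fin.Base using (Fin; zero; suc; toℕ; splitAt; remQuot; _↑ʳ_)
import Data.Fin.Properties as Fin
open import Data.Nat.Base as ℕ using (ℕ)
import Data.Nat.Properties as ℕ
open import Data.Product.Base using (∃-syntax; _×_; _,_)
open import Data.Rational.Base as ℚ using (ℚ; 0ℚ; 1ℚ; ½; ∣_∣)
import Data.Rational.Properties as ℚ
open import Data.Rational.Solver using (module +-*-Solver)
open import Data.Sum.Base as Sum using (_⊎_; inj₁; inj₂)
open import Data.Vec.Functional using (Vector)
open import Function.Base using (_∘_)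
open import Relation.Binary.PropositionalEquality
open import Relation.Nullary.Decidable using (Dec; yes; no; does; dec-true; dec-false)
open import Relation.Nullary.Negation using (contradiction)

------------------------------------------------------------------------
-- Real numbers: Cauchy sequences of rationals, equal when their
-- difference tends to 0.

private
  ½+½ : ∀ p → (½ ℚ.* p) ℚ.+ (½ ℚ.* p) ≡ p
  ½+½ p = trans (sym (ℚ.*-distribʳ-+ p ½ ½)) (ℚ.*-identityˡ p)

  0<p*q : ∀ {p q} → 0ℚ ℚ.< p → 0ℚ ℚ.< q → 0ℚ ℚ.< p ℚ.* q
  0<p*q {p} {q} 0<p 0<q =
    ℚ.positive⁻¹ (p ℚ.* q)
      {{ℚ.pos*pos⇒pos p {{ℚ.positive 0<p}} q {{ℚ.positive 0<q}}}}

  0<½*p : ∀ {p} → 0ℚ ℚ.< p → 0ℚ ℚ.< ½ ℚ.* p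
  0<½*p = 0<p*q (ℚ.positive⁻¹ ½)

  *-mono-≤ : ∀ {p q r s} → 0ℚ ℚ.≤ q → 0ℚ ℚ.≤ r →
             p ℚ.≤ q → r ℚ.≤ s → p ℚ.* r ℚ.≤ q ℚ.* s
  *-mono-≤ {q = q} {r = r} 0≤q 0≤r p≤q r≤s = ℚ.≤-trans
    (ℚ.*-monoʳ-≤-nonNeg r {{ℚ.nonNegative 0≤r}} p≤q)
    (ℚ.*-monoˡ-≤-nonNeg q {{ℚ.nonNegative 0≤q}} r≤s)

  +-close : ∀ a b c d ε → ∣ a ℚ.- c ∣ ℚ.≤ ½ ℚ.* ε → ∣ b ℚ.- d ∣ ℚ.≤ ½ ℚ.* ε →
            ∣ (a ℚ.+ b) ℚ.- (c ℚ.+ d) ∣ ℚ.≤ ε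
  +-close a b c d ε p q = begin
    ∣ (a ℚ.+ b) ℚ.- (c ℚ.+ d) ∣          ≡⟨ cong ∣_∣ (rearrange a b c d) ⟩
    ∣ (a ℚ.- c) ℚ.+ (b ℚ.- d) ∣          ≤⟨ ℚ.∣p+q∣≤∣p∣+∣q∣ (a ℚ.- c) (b ℚ.- d) ⟩
    ∣ a ℚ.- c ∣ ℚ.+ ∣ b ℚ.- d ∣          ≤⟨ ℚ.+-mono-≤ p q ⟩
    ½ ℚ.* ε ℚ.+ ½ ℚ.* ε                  ≡⟨ ½+½ ε ⟩
    ε                                    ∎
    where
    open ℚ.≤-Reasoning
    rearrange : ∀ a b c d → (a ℚ.+ b) ℚ.- (c ℚ.+ d) ≡ (a ℚ.- c) ℚ.+ (b ℚ.- d)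
    rearrange = solve 4 (λ a b c d → (a :+ b) :- (c :+ d) := (a :- c) :+ (b :- d)) refl
      where open +-*-Solver

  *-small : ∀ p q D δ → 0ℚ ℚ.≤ δ → ∣ p ∣ ℚ.≤ δ → ∣ q ∣ ℚ.≤ D → ∣ p ℚ.* q ∣ ℚ.≤ δ ℚ.* D
  *-small p q D δ 0≤δ p≤δ q≤D = subst (ℚ._≤ δ ℚ.* D) (sym (ℚ.∣p*q∣≡∣p∣*∣q∣ p q))
    (*-mono-≤ 0≤δ (ℚ.0≤∣p∣ q) p≤δ q≤D)

  *-close : ∀ a b c d D δ ε → 0ℚ ℚ.≤ δ → δ ℚ.* D ≡ ½ ℚ.* ε →
            ∣ a ∣ ℚ.≤ D → ∣ d ∣ ℚ.≤ D → ∣ a ℚ.- c ∣ ℚ.≤ δ → ∣ b ℚ.- d ∣ ℚ.≤ δ →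
            ∣ a ℚ.* b ℚ.- c ℚ.* d ∣ ℚ.≤ ε
  *-close a b c d D δ ε 0≤δ δD≡½ε a≤D d≤D p q = begin
    ∣ a ℚ.* b ℚ.- c ℚ.* d ∣
      ≡⟨ cong ∣_∣ (split a b c d) ⟩
    ∣ (b ℚ.- d) ℚ.* a ℚ.+ (a ℚ.- c) ℚ.* d ∣
      ≤⟨ ℚ.∣p+q∣≤∣p∣+∣q∣ ((b ℚ.- d) ℚ.* a) ((a ℚ.- c) ℚ.* d) ⟩
    ∣ (b ℚ.- d) ℚ.* a ∣ ℚ.+ ∣ (a ℚ.- c) ℚ.* d ∣
      ≤⟨ ℚ.+-mono-≤ (*-small (b ℚ.- d) a D δ 0≤δ q a≤D)
                    (*-small (a ℚ.- c) d D δ 0≤δ p d≤D) ⟩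
    δ ℚ.* D ℚ.+ δ ℚ.* D
      ≡⟨ cong₂ ℚ._+_ δD≡½ε δD≡½ε ⟩
    ½ ℚ.* ε ℚ.+ ½ ℚ.* ε
      ≡⟨ ½+½ ε ⟩
    ε ∎
    where
    open ℚ.≤-Reasoning
    split : ∀ a b c d → a ℚ.* b ℚ.- c ℚ.* d ≡ (b ℚ.- d) ℚ.* a ℚ.+ (a ℚ.- c) ℚ.* d
    split = solve 4 (λ a b c d → a :* b :- c :* d := (b :- d) :* a :+ (a :- c) :* d) refl
      where open +-*-Solver

  quotient : ∀ ε D → 0ℚ ℚ.< ε → 0ℚ ℚ.< D → ∃[ δ ] (0ℚ ℚ.< δ × δ ℚ.* D ≡ ½ ℚ.* ε)
  quotient ε D 0<ε 0<D = (½ ℚ.* ε) ℚ.* ℚ.1/ D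
    , 0<p*q (0<½*p 0<ε) (ℚ.positive⁻¹ (ℚ.1/ D) {{ℚ.1/pos⇒pos D}})
    , trans (ℚ.*-assoc (½ ℚ.* ε) (ℚ.1/ D) D)
        (trans (cong ((½ ℚ.* ε) ℚ.*_) (ℚ.*-inverseˡ D)) (ℚ.*-identityʳ (½ ℚ.* ε)))
    where
    instance
      D-positive : ℚ.Positive D
      D-positive = ℚ.positive 0<D
      D-nonZero : ℚ.NonZero D
      D-nonZero = ℚ.pos⇒nonZero D

  ∣∣-bound : ∀ a b → ∣ a ℚ.- b ∣ ℚ.≤ 1ℚ → ∣ a ∣ ℚ.≤ ∣ b ∣ ℚ.+ 1ℚ
  ∣∣-bound a b p = begin
    ∣ a ∣                        ≡⟨ cong ∣_∣ (split a b) ⟩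
    ∣ b ℚ.+ (a ℚ.- b) ∣          ≤⟨ ℚ.∣p+q∣≤∣p∣+∣q∣ b (a ℚ.- b) ⟩
    ∣ b ∣ ℚ.+ ∣ a ℚ.- b ∣        ≤⟨ ℚ.+-monoʳ-≤ ∣ b ∣ p ⟩
    ∣ b ∣ ℚ.+ 1ℚ                 ∎
    where
    open ℚ.≤-Reasoning
    split : ∀ a b → a ≡ b ℚ.+ (a ℚ.- b)
    split = solve 2 (λ a b → a := b :+ (a :- b)) refl
      where open +-*-Solver

IsCauchy : (ℕ → ℚ) → Set
IsCauchy x = ∀ ε → 0ℚ ℚ.< ε →
  ∃[ N ] (∀ m n → N ℕ.≤ m → N ℕ.≤ n → ∣ x m ℚ.- x n ∣ ℚ.≤ ε)

record ℝ : Set where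
  constructor mkℝ
  field
    seq    : ℕ → ℚ
    cauchy : IsCauchy seq

open ℝ public

infix 4 _≃_ _<_

record _≃_ (x y : ℝ) : Set where
  constructor mk≃
  field
    close : ∀ ε → 0ℚ ℚ.< ε →
      ∃[ N ] (∀ n → N ℕ.≤ n → ∣ seq x n ℚ.- seq y n ∣ ℚ.≤ ε)

record _<_ (x y : ℝ) : Set where
  constructor mk<
  field
    gap       : ℚ
    0<gap     : 0ℚ ℚ.< gap
    separated : ∃[ N ] (∀ n → N ℕ.≤ n → seq x n ℚ.+ gap ℚ.≤ seq y n)

-- Only the sequences matter below, and unfolding these proofs is costly.
abstract
  const-cauchy : ∀ q → IsCauchy (λ _ → q)
  const-cauchy q ε 0<ε = 0 , λ _ _ _ _ →
    subst (ℚ._≤ ε) (cong ∣_∣ (sym (ℚ.+-inverseʳ q))) (ℚ.<⇒≤ 0<ε)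

fromℚ : ℚ → ℝ
fromℚ q = mkℝ (λ _ → q) (const-cauchy q)

0ℝ 1ℝ : ℝ
0ℝ = fromℚ 0ℚ
1ℝ = fromℚ 1ℚ

infixl 6 _+_ _-_
infixl 7 _*_
infix  8 -_

abstract
  +-cauchy : ∀ x y → IsCauchy (λ n → seq x n ℚ.+ seq y n)
  +-cauchy x y ε 0<ε =
    let M , x-close = cauchy x (½ ℚ.* ε) (0<½*p 0<ε)
        N , y-close = cauchy y (½ ℚ.* ε) (0<½*p 0<ε)
    in M ℕ.⊔ N , λ m n p q → +-close (seq x m) (seq y m) (seq x n) (seq y n) ε
         (x-close m n (ℕ.m⊔n≤o⇒m≤o M N p) (ℕ.m⊔n≤o⇒m≤o M N q))
         (y-close m n (ℕ.m⊔n≤o⇒n≤o M N p) (ℕ.m⊔n≤o⇒n≤o M N q))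

_+_ : ℝ → ℝ → ℝ
x + y = mkℝ (λ n → seq x n ℚ.+ seq y n) (+-cauchy x y)

abstract
  neg-cauchy : ∀ x → IsCauchy (λ n → ℚ.- seq x n)
  neg-cauchy x ε 0<ε =
    let N , x-close = cauchy x ε 0<ε
    in N , λ m n p q → subst (ℚ._≤ ε)
         (trans (sym (ℚ.∣-p∣≡∣p∣ (seq x m ℚ.- seq x n)))
                (cong ∣_∣ (ℚ.neg-distrib-+ (seq x m) (ℚ.- seq x n))))
         (x-close m n p q)

-_ : ℝ → ℝ
- x = mkℝ (λ n → ℚ.- seq x n) (neg-cauchy x)

_-_ : ℝ → ℝ → ℝ
x - y = x + (- y)

abstract
  bounded : ∀ x → ∃[ B ] (0ℚ ℚ.< B × ∃[ N ] (∀ n → N ℕ.≤ n → ∣ seq x n ∣ ℚ.≤ B))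
  bounded x =
    let N , x-close = cauchy x 1ℚ (ℚ.positive⁻¹ 1ℚ)
    in ∣ seq x N ∣ ℚ.+ 1ℚ
       , ℚ.+-mono-≤-< (ℚ.0≤∣p∣ (seq x N)) (ℚ.positive⁻¹ 1ℚ)
       , N , λ n p → ∣∣-bound (seq x n) (seq x N) (x-close n N p ℕ.≤-refl)

  *-cauchy : ∀ x y → IsCauchy (λ n → seq x n ℚ.* seq y n)
  *-cauchy x y ε 0<ε =
    let B , 0<B , K , x≤B = bounded x
        C , 0<C , L , y≤C = bounded y
        B≤B+C = subst (ℚ._≤ B ℚ.+ C) (ℚ.+-identityʳ B) (ℚ.+-monoʳ-≤ B (ℚ.<⇒≤ 0<C))
        C≤B+C = subst (ℚ._≤ B ℚ.+ C) (ℚ.+-identityˡ C) (ℚ.+-monoˡ-≤ C (ℚ.<⇒≤ 0<B))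
        δ , 0<δ , δ[B+C]≡½ε = quotient ε (B ℚ.+ C) 0<ε (ℚ.+-mono-< 0<B 0<C)
        M , x-close = cauchy x δ 0<δ
        N , y-close = cauchy y δ 0<δ
        ≥KL : ∀ {k} → (K ℕ.⊔ L) ℕ.⊔ (M ℕ.⊔ N) ℕ.≤ k → K ℕ.⊔ L ℕ.≤ k
        ≥KL = ℕ.m⊔n≤o⇒m≤o (K ℕ.⊔ L) (M ℕ.⊔ N)
        ≥MN : ∀ {k} → (K ℕ.⊔ L) ℕ.⊔ (M ℕ.⊔ N) ℕ.≤ k → M ℕ.⊔ N ℕ.≤ k
        ≥MN = ℕ.m⊔n≤o⇒n≤o (K ℕ.⊔ L) (M ℕ.⊔ N)
    in (K ℕ.⊔ L) ℕ.⊔ (M ℕ.⊔ N) , λ m n p q →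
       *-close (seq x m) (seq y m) (seq x n) (seq y n) (B ℚ.+ C) δ ε (ℚ.<⇒≤ 0<δ) δ[B+C]≡½ε
         (ℚ.≤-trans (x≤B m (ℕ.m⊔n≤o⇒m≤o K L (≥KL p))) B≤B+C)
         (ℚ.≤-trans (y≤C n (ℕ.m⊔n≤o⇒n≤o K L (≥KL q))) C≤B+C)
         (x-close m n (ℕ.m⊔n≤o⇒m≤o M N (≥MN p)) (ℕ.m⊔n≤o⇒m≤o M N (≥MN q)))
         (y-close m n (ℕ.m⊔n≤o⇒n≤o M N (≥MN p)) (ℕ.m⊔n≤o⇒n≤o M N (≥MN q)))

_*_ : ℝ → ℝ → ℝ
x * y = mkℝ (λ n → seq x n ℚ.* seq y n) (*-cauchy x y)

ℝ-rawRing : RawRing _ _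
ℝ-rawRing = record
  { Carrier = ℝ
  ; _≈_ = _≃_
  ; _+_ = _+_
  ; _*_ = _*_
  ; -_  = -_
  ; 0#  = 0ℝ
  ; 1#  = 1ℝ
  }

open RawSemiringDefs (RawRing.rawSemiring ℝ-rawRing) public using (sum; _^_)

------------------------------------------------------------------------
-- Eigenvalues

Matrix : ℕ → Set
Matrix n = Fin n → Fin n → ℝ

infix  4 _≋_
infixr 7 _*ᵥ_ _·ᵥ_

_≋_ : ∀ {n} → Vector ℝ n → Vector ℝ n → Set
v ≋ w = ∀ i → v i ≃ w i

_*ᵥ_ : ∀ {n} → Matrix n → Vector ℝ n → Vector ℝ n
(A *ᵥ v) i = sum λ j → A i j * v j

_·ᵥ_ : ∀ {n} → ℝ → Vector ℝ n → Vector ℝ n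
(c ·ᵥ v) i = c * v i

linearCombination : ∀ {m n} → Vector ℝ m → (Fin m → Vector ℝ n) → Vector ℝ n
linearCombination c v i = sum λ j → c j * v j i

LinearlyIndependent : ∀ {m n} → (Fin m → Vector ℝ n) → Set
LinearlyIndependent v = ∀ c → linearCombination c v ≋ (λ _ → 0ℝ) → ∀ j → c j ≃ 0ℝ

Spanning : ∀ {m n} → (Fin m → Vector ℝ n) → Set
Spanning v = ∀ w → ∃[ c ] linearCombination c v ≋ w

IsBasis : ∀ {m n} → (Fin m → Vector ℝ n) → Set
IsBasis v = LinearlyIndependent v × Spanning v

-- The eigenvalues of a diagonalisable (e.g. real symmetric) matrix, counted
-- with multiplicity: in a basis of eigenvectors each eigenvalue occurs as
-- often as the dimension of its eigenspace.  The order on ℝ is not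
-- decidable constructively, so the positivity tests are part of the data.
record Spectrum {n} (A : Matrix n) : Set where
  field
    eigenvalue  : Fin n → ℝ
    eigenvector : Fin n → Vector ℝ n
    isBasis     : IsBasis eigenvector
    isEigen     : ∀ j → A *ᵥ eigenvector j ≋ eigenvalue j ·ᵥ eigenvector j
    positive?   : ∀ j → Dec (0ℝ < eigenvalue j)

------------------------------------------------------------------------
-- Finite simple graphs

record Graph (n : ℕ) : Set where
  field
    adjacent    : Fin n → Fin n → Bool
    symmetric   : ∀ i j → adjacent i j ≡ adjacent j i
    irreflexive : ∀ i → adjacent i i ≡ false

open Graph public

adjacencyMatrix : ∀ {n} → Graph n → Matrix n
adjacencyMatrix G i j = if adjacent G i j then 1ℝ else 0ℝ

𝓔₄⁺ : ∀ {n} (G : Graph n) → Spectrum (adjacencyMatrix G) → ℝ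
𝓔₄⁺ G S = sum λ j → if does (positive? j) then eigenvalue j ^ 4 else 0ℝ
  where open Spectrum S

infix 5 _==_

_==_ : ∀ {n} → Fin n → Fin n → Bool
i == j = does (i Fin.≟ j)

==-sym : ∀ {n} (i j : Fin n) → (i == j) ≡ (j == i)
==-sym i j with i Fin.≟ j
... | yes i≡j = sym (dec-true (j Fin.≟ i) (sym i≡j))
... | no  i≢j = sym (dec-false (j Fin.≟ i) (i≢j ∘ sym))

==-refl : ∀ {n} (i : Fin n) → (i == i) ≡ true
==-refl i = dec-true (i Fin.≟ i) refl

addEdge : ∀ {n} → Graph n → (a b : Fin n) → a ≢ b → Graph n
addEdge G a b a≢b = record
  { adjacent    = λ i j → adjacent G i j ∨ (isEdge i j ∨ isEdge j i)
  ; symmetric   = λ i j → cong₂ _∨_ (symmetric G i j) (∨-comm (isEdge i j) (isEdge j i))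
  ; irreflexive = λ i → cong₂ _∨_ (irreflexive G i) (cong₂ _∨_ (noLoop i) (noLoop i))
  }
  where
  isEdge : _ → _ → Bool
  isEdge i j = (i == a) ∧ (j == b)

  noLoop : ∀ i → isEdge i i ≡ false
  noLoop i with i Fin.≟ a | i Fin.≟ b
  ... | yes i≡a | yes i≡b = contradiction (trans (sym i≡a) i≡b) a≢b
  ... | yes _   | no  _   = refl
  ... | no  _   | _       = refl

------------------------------------------------------------------------
-- The graphs J₀ and J₁.  The cliques C₁, …, C₄ are indexed from 0.

Vertex : Set
Vertex = (Fin 4 × Fin 9) ⊎ Fin 2

pattern inClique i a = inj₁ (i , a)
pattern u = inj₂ zero
pattern v = inj₂ (suc zero)

pattern C₁ = zero
pattern C₄ = suc (suc (suc zero))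

consecutive : Fin 4 → Fin 4 → Bool
consecutive i j = does (toℕ j ℕ.≟ ℕ.suc (toℕ i))

adjacentJ₀ : Vertex → Vertex → Bool
adjacentJ₀ (inClique i a) (inClique j b) =
  ((i == j) ∧ not (a == b)) ∨ (consecutive i j ∨ consecutive j i)
adjacentJ₀ (inClique i a) u = i == C₁
adjacentJ₀ (inClique i a) v = i == C₄
adjacentJ₀ u (inClique j b) = j == C₁
adjacentJ₀ v (inClique j b) = j == C₄
adjacentJ₀ u u = false
adjacentJ₀ u v = false
adjacentJ₀ v u = false
adjacentJ₀ v v = false

adjacentJ₀-sym : ∀ x y → adjacentJ₀ x y ≡ adjacentJ₀ y x
adjacentJ₀-sym (inClique i a) (inClique j b) = cong₂ _∨_
  (cong₂ (λ s t → s ∧ not t) (==-sym i j) (==-sym a b))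
  (∨-comm (consecutive i j) (consecutive j i))
adjacentJ₀-sym (inClique i a) u = refl
adjacentJ₀-sym (inClique i a) v = refl
adjacentJ₀-sym u (inClique j b) = refl
adjacentJ₀-sym v (inClique j b) = refl
adjacentJ₀-sym u u = refl
adjacentJ₀-sym u v = refl
adjacentJ₀-sym v u = refl
adjacentJ₀-sym v v = refl

adjacentJ₀-irrefl : ∀ x → adjacentJ₀ x x ≡ false
adjacentJ₀-irrefl (inClique i a) rewrite ==-refl i | ==-refl a =
  cong₂ _∨_ notConsecutive notConsecutive
  where
  notConsecutive : consecutive i i ≡ false
  notConsecutive = dec-false (toℕ i ℕ.≟ ℕ.suc (toℕ i)) (ℕ.1+n≢n ∘ sym)
adjacentJ₀-irrefl u = refl
adjacentJ₀-irrefl v = refl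

-- A bijection: splitAt and remQuot are the maps of Fin.+↔⊎ and Fin.*↔×.
vertex : Fin 38 → Vertex
vertex i = Sum.map₁ (remQuot 9) (splitAt 36 i)

J₀ : Graph 38
J₀ = record
  { adjacent    = λ i j → adjacentJ₀ (vertex i) (vertex j)
  ; symmetric   = λ i j → adjacentJ₀-sym (vertex i) (vertex j)
  ; irreflexive = λ i → adjacentJ₀-irrefl (vertex i)
  }

uᵢ vᵢ : Fin 38
uᵢ = 36 ↑ʳ zero
vᵢ = 36 ↑ʳ suc zero

vertex-uᵢ : vertex uᵢ ≡ u
vertex-uᵢ = refl

vertex-vᵢ : vertex vᵢ ≡ v
vertex-vᵢ = refl

J₁ : Graph 38
J₁ = addEdge J₀ uᵢ vᵢ λ ()

module Submission where

-- The matrix K = A + I of each graph has entries depending only on the classes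
-- C₁, …, C₄, {u}, {v} of its indices, so the traces of its powers are integers
-- given by 6 × 6 tables, and they equal the power sums of the κ = λ + 1.
-- Choose an integer polynomial S with S(κ)² ≈ D ∣λ∣ at every eigenvalue, for a
-- large constant D.  Then λ₊⁴ = λ³ (λ + ∣λ∣) / 2 ≈ λ³ (D λ + S(κ)²) / 2 D, whose
-- sum is again a trace; and the approximation needs no knowledge of the
-- eigenvalues, because the sum of squares Σ (S(κ)⁴ − D² λ²)² is a trace as well
-- and bounds each of its terms.  Everything reduces to inequalities between
-- integers, which yield 𝓔₄⁺(J₀) = 303301 ± 1/5 and 𝓔₄⁺(J₁) = 303297 ± 1/5.

open import Defs
open import Algebra.Bundles using (CommutativeRing)
import Algebra.Properties.Ring as RingProperties
import Algebra.Properties.Semiring.Sum as SemiringSum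
open import Data.Bool.Base using (Bool; true; false; _∧_; _∨_; not; if_then_else_)
import Data.Bool.Properties as Bool
open import Data.Fin.Base using (Fin; zero; suc; join)
open import Data.Fin.Patterns using (0F; 1F; 2F; 3F; 4F; 5F)
import Data.Fin.Properties as Fin
open import Data.Integer.Base as ℤ using (ℤ; +_; -[1+_])
import Data.Integer.Properties as ℤ
open import Data.List.Base using (List; []; _∷_)
open import Data.Nat.Base as ℕ using (ℕ)
import Data.Nat.Properties as ℕ
open import Data.Product.Base using (∃-syntax; _×_; _,_; proj₁; proj₂)
open import Data.Rational.Base as ℚ using (ℚ; 0ℚ; 1ℚ; ½; ∣_∣; _/_) renaming (-_ to -ℚ_)
open import Data.Rational.Literals using (fromℤ)
import Data.Rational.Properties as ℚ
open import Data.Rational.Solver using (module +-*-Solver)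
import Data.Rational.Unnormalised.Base as ℚᵘ
import Data.Rational.Unnormalised.Properties as ℚᵘ
open import Data.Sum.Base as Sum using (_⊎_; inj₁; inj₂)
open import Data.Unit.Base using (tt)
open import Data.Vec.Base as Vec using (Vec)
import Data.Vec.Properties as Vec
open import Data.Vec.Functional using (Vector)
open import Function.Base using (_∘_)
open import Level using (0ℓ)
open import Relation.Binary.PropositionalEquality as ≡ using (_≡_; cong; cong₂)
import Relation.Binary.Reasoning.Setoid as SetoidReasoning
open import Relation.Nullary.Decidable using (Dec; yes; no; does; toWitness)
open import Relation.Nullary.Negation using (¬_)

open +-*-Solver using (solve; _:=_; _:+_; _:*_; _:-_; :-_; con)
open SemiringSum ℤ.+-*-semiring using () renaming (sum to sumℤ)
open SemiringSum (CommutativeRing.semiring ℚ.+-*-commutativeRing)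
  using () renaming (sum to sumℚ; sum-cong-≗ to sumℚ-cong)

-- Sequences of rationals

Eventually : (ℕ → Set) → Set
Eventually P = ∃[ N ] (∀ n → N ℕ.≤ n → P n)

always : ∀ {P} → (∀ n → P n) → Eventually P
always p = 0 , λ n _ → p n

eventually-map : ∀ {P Q} → (∀ n → P n → Q n) → Eventually P → Eventually Q
eventually-map f (N , p) = N , λ n N≤n → f n (p n N≤n)

eventually-zip : ∀ {P Q R} → (∀ n → P n → Q n → R n) →
                 Eventually P → Eventually Q → Eventually R
eventually-zip f (M , p) (N , q) = M ℕ.⊔ N , λ n M⊔N≤n →
  f n (p n (ℕ.m⊔n≤o⇒m≤o M N M⊔N≤n)) (q n (ℕ.m⊔n≤o⇒n≤o M N M⊔N≤n))

eventually-∀Fin : ∀ {m} {P : Fin m → ℕ → Set} →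
                  (∀ i → Eventually (P i)) → Eventually (λ n → ∀ i → P i n)
eventually-∀Fin {ℕ.zero}  _ = always λ _ ()
eventually-∀Fin {ℕ.suc m} p = eventually-zip
  (λ { n p₀ pₛ zero → p₀ ; n p₀ pₛ (suc i) → pₛ i })
  (p zero) (eventually-∀Fin (p ∘ suc))

0<p*q : ∀ {p q} → 0ℚ ℚ.< p → 0ℚ ℚ.< q → 0ℚ ℚ.< p ℚ.* q
0<p*q {p} {q} 0<p 0<q =
  ℚ.positive⁻¹ (p ℚ.* q)
    {{ℚ.pos*pos⇒pos p {{ℚ.positive 0<p}} q {{ℚ.positive 0<q}}}}

*-mono-≤-nonNeg : ∀ {p q r s} → 0ℚ ℚ.≤ q → 0ℚ ℚ.≤ r →
                  p ℚ.≤ q → r ℚ.≤ s → p ℚ.* r ℚ.≤ q ℚ.* s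
*-mono-≤-nonNeg {q = q} {r = r} 0≤q 0≤r p≤q r≤s = ℚ.≤-trans
  (ℚ.*-monoʳ-≤-nonNeg r {{ℚ.nonNegative 0≤r}} p≤q)
  (ℚ.*-monoˡ-≤-nonNeg q {{ℚ.nonNegative 0≤q}} r≤s)

½+½ : ∀ p → ½ ℚ.* p ℚ.+ ½ ℚ.* p ≡ p
½+½ p = ≡.trans (≡.sym (ℚ.*-distribʳ-+ p ½ ½)) (ℚ.*-identityˡ p)

-- The field `close` of `x ≃ y` is definitionally `Null` of the difference of the two sequences.
-- Each congruence law thus reduces to a polynomial identity expressing one difference through other
-- null sequences.
Null : (ℕ → ℚ) → Set
Null f = ∀ ε → 0ℚ ℚ.< ε → Eventually (λ n → ∣ f n ∣ ℚ.≤ ε)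

null-cong : ∀ {f g} → (∀ n → f n ≡ g n) → Null f → Null g
null-cong f≗g null ε 0<ε =
  eventually-map (λ n → ≡.subst (λ q → ∣ q ∣ ℚ.≤ ε) (f≗g n)) (null ε 0<ε)

null-0 : Null (λ _ → 0ℚ)
null-0 ε 0<ε = always λ _ → ℚ.<⇒≤ 0<ε

null-neg : ∀ {f} → Null f → Null (λ n → ℚ.- f n)
null-neg {f} null ε 0<ε =
  eventually-map (λ n → ≡.subst (ℚ._≤ ε) (≡.sym (ℚ.∣-p∣≡∣p∣ (f n)))) (null ε 0<ε)

null-+ : ∀ {f g} → Null f → Null g → Null (λ n → f n ℚ.+ g n)
null-+ {f} {g} nullf nullg ε 0<ε = eventually-zip
  (λ n p q → ℚ.≤-trans (ℚ.∣p+q∣≤∣p∣+∣q∣ (f n) (g n))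
               (≡.subst (∣ f n ∣ ℚ.+ ∣ g n ∣ ℚ.≤_) (½+½ ε) (ℚ.+-mono-≤ p q)))
  (nullf (½ ℚ.* ε) 0<½ε) (nullg (½ ℚ.* ε) 0<½ε)
  where
  0<½ε : 0ℚ ℚ.< ½ ℚ.* ε
  0<½ε = 0<p*q (ℚ.positive⁻¹ ½) 0<ε

-- The second factor is the sequence of a real, hence eventually bounded by some `B`; it then
-- suffices that `f` is eventually within `ε / B` of 0.
null-* : ∀ {f} → Null f → ∀ x → Null (λ n → f n ℚ.* seq x n)
null-* {f} null x ε 0<ε with bounded x
... | B , 0<B , x≤B = eventually-zip
  (λ n p q → ≡.subst₂ ℚ._≤_ (≡.sym (ℚ.∣p*q∣≡∣p∣*∣q∣ (f n) (seq x n))) δB≡ε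
               (*-mono-≤-nonNeg (ℚ.<⇒≤ 0<δ) (ℚ.0≤∣p∣ (seq x n)) p q))
  (null δ 0<δ) x≤B
  where
  instance
    B-positive : ℚ.Positive B
    B-positive = ℚ.positive 0<B
    B-nonZero : ℚ.NonZero B
    B-nonZero = ℚ.pos⇒nonZero B
  δ : ℚ
  δ = ε ℚ.* ℚ.1/ B
  0<δ : 0ℚ ℚ.< δ
  0<δ = 0<p*q 0<ε (ℚ.positive⁻¹ (ℚ.1/ B) {{ℚ.1/pos⇒pos B}})
  δB≡ε : δ ℚ.* B ≡ ε
  δB≡ε = ≡.trans (ℚ.*-assoc ε (ℚ.1/ B) B)
           (≡.trans (cong (ε ℚ.*_) (ℚ.*-inverseˡ B)) (ℚ.*-identityʳ ε))

-- The ring of real numbers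

≃⇒null : ∀ {x y} → x ≃ y → Null (λ n → seq x n ℚ.- seq y n)
≃⇒null (mk≃ close) = close

-- The operations on `ℝ` act term by term, so the ring axioms follow from those of `ℚ` at each
-- index, without any limit argument.
≗⇒≃ : ∀ {x y} → (∀ n → seq x n ≡ seq y n) → x ≃ y
≗⇒≃ {x} {y} x≗y = mk≃ (null-cong
  (λ n → ≡.sym (≡.trans (cong (ℚ._- seq y n) (x≗y n)) (ℚ.+-inverseʳ (seq y n)))) null-0)

≃-refl : ∀ {x} → x ≃ x
≃-refl = ≗⇒≃ λ _ → ≡.refl

≃-sym : ∀ {x y} → x ≃ y → y ≃ x
≃-sym {x} {y} (mk≃ p) = mk≃ (null-cong (λ n → swap (seq x n) (seq y n)) (null-neg p))
  where
  swap : ∀ a b → ℚ.- (a ℚ.- b) ≡ b ℚ.- a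
  swap = solve 2 (λ a b → :- (a :- b) := b :- a) ≡.refl

≃-trans : ∀ {x y z} → x ≃ y → y ≃ z → x ≃ z
≃-trans {x} {y} {z} (mk≃ p) (mk≃ q) =
  mk≃ (null-cong (λ n → telescope (seq x n) (seq y n) (seq z n)) (null-+ p q))
  where
  telescope : ∀ a b c → (a ℚ.- b) ℚ.+ (b ℚ.- c) ≡ a ℚ.- c
  telescope = solve 3 (λ a b c → (a :- b) :+ (b :- c) := a :- c) ≡.refl

+-cong : ∀ {x y w z} → x ≃ y → w ≃ z → x + w ≃ y + z
+-cong {x} {y} {w} {z} (mk≃ p) (mk≃ q) =
  mk≃ (null-cong (λ n → rearrange (seq x n) (seq y n) (seq w n) (seq z n)) (null-+ p q))
  where
  rearrange : ∀ a b c d → (a ℚ.- b) ℚ.+ (c ℚ.- d) ≡ (a ℚ.+ c) ℚ.- (b ℚ.+ d)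
  rearrange = solve 4 (λ a b c d → (a :- b) :+ (c :- d) := (a :+ c) :- (b :+ d)) ≡.refl

*-cong : ∀ {x y w z} → x ≃ y → w ≃ z → x * w ≃ y * z
*-cong {x} {y} {w} {z} (mk≃ p) (mk≃ q) = mk≃ (null-cong
  (λ n → rearrange (seq x n) (seq y n) (seq w n) (seq z n))
  (null-+ (null-* p w) (null-* q y)))
  where
  rearrange : ∀ a b c d →
    (a ℚ.- b) ℚ.* c ℚ.+ (c ℚ.- d) ℚ.* b ≡ a ℚ.* c ℚ.- b ℚ.* d
  rearrange = solve 4
    (λ a b c d → (a :- b) :* c :+ (c :- d) :* b := a :* c :- b :* d) ≡.refl

neg-cong : ∀ {x y} → x ≃ y → - x ≃ - y
neg-cong {x} {y} (mk≃ p) =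
  mk≃ (null-cong (λ n → ℚ.neg-distrib-+ (seq x n) (ℚ.- seq y n)) (null-neg p))

ℝ-commutativeRing : CommutativeRing 0ℓ 0ℓ
ℝ-commutativeRing = record
  { Carrier = ℝ
  ; _≈_ = _≃_
  ; _+_ = _+_
  ; _*_ = _*_
  ; -_  = -_
  ; 0#  = 0ℝ
  ; 1#  = 1ℝ
  ; isCommutativeRing = record
    { isRing = record
      { +-isAbelianGroup = record
        { isGroup = record
          { isMonoid = record
            { isSemigroup = record
              { isMagma = record
                { isEquivalence = record
                  { refl = ≃-refl ; sym = ≃-sym ; trans = ≃-trans }
                ; ∙-cong = +-cong
                }
              ; assoc = λ x y z → ≗⇒≃ λ n → ℚ.+-assoc (seq x n) (seq y n) (seq z n)
              }
            ; identity = (λ x → ≗⇒≃ λ n → ℚ.+-identityˡ (seq x n))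
                       , (λ x → ≗⇒≃ λ n → ℚ.+-identityʳ (seq x n))
            }
          ; inverse = (λ x → ≗⇒≃ λ n → ℚ.+-inverseˡ (seq x n))
                    , (λ x → ≗⇒≃ λ n → ℚ.+-inverseʳ (seq x n))
          ; ⁻¹-cong = neg-cong
          }
        ; comm = λ x y → ≗⇒≃ λ n → ℚ.+-comm (seq x n) (seq y n)
        }
      ; *-cong = *-cong
      ; *-assoc = λ x y z → ≗⇒≃ λ n → ℚ.*-assoc (seq x n) (seq y n) (seq z n)
      ; *-identity = (λ x → ≗⇒≃ λ n → ℚ.*-identityˡ (seq x n))
                   , (λ x → ≗⇒≃ λ n → ℚ.*-identityʳ (seq x n))
      ; distrib = (λ x y z → ≗⇒≃ λ n → ℚ.*-distribˡ-+ (seq x n) (seq y n) (seq z n))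
                , (λ x y z → ≗⇒≃ λ n → ℚ.*-distribʳ-+ (seq x n) (seq y n) (seq z n))
      }
    ; *-comm = λ x y → ≗⇒≃ λ n → ℚ.*-comm (seq x n) (seq y n)
    }
  }

open CommutativeRing ℝ-commutativeRing
  using ( setoid; ring; semiring; +-assoc; +-congˡ; *-congˡ; *-congʳ
        ; +-identityˡ; +-identityʳ; *-identityˡ; *-identityʳ; zeroˡ; zeroʳ
        ; *-assoc; *-comm; distribˡ; distribʳ; -‿inverseˡ; -‿inverseʳ)
open RingProperties ring using (-1*x≈-x)
open SemiringSum semiring
  using (∑-comm; ∑-distrib-+; *-distribˡ-sum; *-distribʳ-sum; sum-replicate-zero)
  renaming (sum-cong-≋ to sum-cong)
module ≃-Reasoning = SetoidReasoning setoid

-- Integers as rationals and as reals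

fromℤ-+ : ∀ i j → fromℤ (i ℤ.+ j) ≡ fromℤ i ℚ.+ fromℤ j
fromℤ-+ i j = ℚ.toℚᵘ-injective (ℚᵘ.≃-trans
  (ℚᵘ.*≡* (cong (ℤ._* + 1) (≡.sym (cong₂ ℤ._+_ (ℤ.*-identityʳ i) (ℤ.*-identityʳ j)))))
  (ℚᵘ.≃-sym (ℚ.toℚᵘ-homo-+ (fromℤ i) (fromℤ j))))

fromℤ-* : ∀ i j → fromℤ (i ℤ.* j) ≡ fromℤ i ℚ.* fromℤ j
fromℤ-* i j = ℚ.toℚᵘ-injective (ℚᵘ.≃-sym (ℚ.toℚᵘ-homo-* (fromℤ i) (fromℤ j)))

fromℤ-mono-≤ : ∀ {i j} → i ℤ.≤ j → fromℤ i ℚ.≤ fromℤ j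
fromℤ-mono-≤ i≤j = ℚ.*≤* (ℤ.*-monoʳ-≤-nonNeg (+ 1) i≤j)

fromℤ-mono-< : ∀ {i j} → i ℤ.< j → fromℤ i ℚ.< fromℤ j
fromℤ-mono-< i<j = ℚ.*<* (ℤ.*-monoʳ-<-pos (+ 1) i<j)

fromℤ-neg : ∀ i → fromℤ (ℤ.- i) ≡ ℚ.- fromℤ i
fromℤ-neg (+ ℕ.zero)  = ≡.refl
fromℤ-neg (+ ℕ.suc _) = ≡.refl
fromℤ-neg -[1+ _ ]    = ≡.refl

ι : ℤ → ℝ
ι i = fromℚ (fromℤ i)

ι-+ : ∀ i j → ι (i ℤ.+ j) ≃ ι i + ι j
ι-+ i j = ≗⇒≃ λ _ → fromℤ-+ i j

ι-* : ∀ i j → ι (i ℤ.* j) ≃ ι i * ι j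
ι-* i j = ≗⇒≃ λ _ → fromℤ-* i j

ι-sum : ∀ {n} (f : Fin n → ℤ) → ι (sumℤ f) ≃ sum (ι ∘ f)
ι-sum {ℕ.zero}  f = ≗⇒≃ λ _ → ≡.refl
ι-sum {ℕ.suc n} f = ≃-trans (ι-+ (f zero) (sumℤ (f ∘ suc))) (+-congˡ (ι-sum (f ∘ suc)))

indicator : Bool → ℤ
indicator b = if b then + 1 else + 0

ιindicator≃ : ∀ b → ι (indicator b) ≃ (if b then 1ℝ else 0ℝ)
ιindicator≃ false = ≗⇒≃ λ _ → ≡.refl
ιindicator≃ true  = ≗⇒≃ λ _ → ≡.refl

-- Matrices and traces

infixl 7 _*ᴹ_
infixr 8 _^ᴹ_

1ᴹ : ∀ {n} → Matrix n
1ᴹ i j = if i == j then 1ℝ else 0ℝ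

_*ᴹ_ : ∀ {n} → Matrix n → Matrix n → Matrix n
(A *ᴹ B) i j = sum λ l → A i l * B l j

_^ᴹ_ : ∀ {n} → Matrix n → ℕ → Matrix n
A ^ᴹ ℕ.zero  = 1ᴹ
A ^ᴹ ℕ.suc k = A *ᴹ A ^ᴹ k

trace : ∀ {n} → Matrix n → ℝ
trace A = sum λ i → A i i

if-cong : ∀ {b c : Bool} {x y : ℝ} → b ≡ c → (if b then x else y) ≃ (if c then x else y)
if-cong ≡.refl = ≃-refl

sum-1ᴹ : ∀ {n} (i : Fin n) (x : Vector ℝ n) → sum (λ j → 1ᴹ i j * x j) ≃ x i
sum-1ᴹ {ℕ.suc n} zero x = begin
  1ℝ * x zero + sum (λ j → 0ℝ * x (suc j))
    ≈⟨ +-cong (*-identityˡ (x zero)) (sum-cong {n} λ j → zeroˡ (x (suc j))) ⟩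
  x zero + sum {n} (λ _ → 0ℝ)
    ≈⟨ +-congˡ (sum-replicate-zero n) ⟩
  x zero + 0ℝ
    ≈⟨ +-identityʳ (x zero) ⟩
  x zero ∎
  where open ≃-Reasoning
sum-1ᴹ (suc i) x = begin
  0ℝ * x zero + sum (λ j → 1ᴹ i j * x (suc j))
    ≈⟨ +-cong (zeroˡ (x zero)) (sum-1ᴹ i (x ∘ suc)) ⟩
  0ℝ + x (suc i)
    ≈⟨ +-identityˡ (x (suc i)) ⟩
  x (suc i) ∎
  where open ≃-Reasoning

1ᴹ-sym : ∀ {n} (i j : Fin n) → 1ᴹ i j ≃ 1ᴹ j i
1ᴹ-sym i j = if-cong (==-sym i j)

*ᵥ-assoc : ∀ {n} (A B : Matrix n) (x : Vector ℝ n) → (A *ᴹ B) *ᵥ x ≋ A *ᵥ B *ᵥ x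
*ᵥ-assoc A B x i = begin
  sum (λ j → sum (λ l → A i l * B l j) * x j)
    ≈⟨ sum-cong (λ j → *-distribʳ-sum (x j) (λ l → A i l * B l j)) ⟩
  sum (λ j → sum (λ l → A i l * B l j * x j))
    ≈⟨ ∑-comm (λ j l → A i l * B l j * x j) ⟩
  sum (λ l → sum (λ j → A i l * B l j * x j))
    ≈⟨ sum-cong (λ l → sum-cong λ j → *-assoc (A i l) (B l j) (x j)) ⟩
  sum (λ l → sum (λ j → A i l * (B l j * x j)))
    ≈⟨ sum-cong (λ l → *-distribˡ-sum (A i l) (λ j → B l j * x j)) ⟨
  sum (λ l → A i l * sum (λ j → B l j * x j)) ∎
  where open ≃-Reasoning

^ᴹ-eigen : ∀ {n} {A : Matrix n} {κ x} → A *ᵥ x ≋ κ ·ᵥ x →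
           ∀ k → (A ^ᴹ k) *ᵥ x ≋ (κ ^ k) ·ᵥ x
^ᴹ-eigen {x = x} Ax≋κx ℕ.zero i = ≃-trans (sum-1ᴹ i x) (≃-sym (*-identityˡ (x i)))
^ᴹ-eigen {A = A} {κ} {x} Ax≋κx (ℕ.suc k) i = begin
  ((A ^ᴹ ℕ.suc k) *ᵥ x) i
    ≈⟨ *ᵥ-assoc A (A ^ᴹ k) x i ⟩
  sum (λ j → A i j * ((A ^ᴹ k) *ᵥ x) j)
    ≈⟨ sum-cong (λ j → *-congˡ (^ᴹ-eigen Ax≋κx k j)) ⟩
  sum (λ j → A i j * (κ ^ k * x j))
    ≈⟨ sum-cong (λ j → ≃-trans (≃-sym (*-assoc (A i j) (κ ^ k) (x j)))
         (≃-trans (*-congʳ (*-comm (A i j) (κ ^ k))) (*-assoc (κ ^ k) (A i j) (x j)))) ⟩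
  sum (λ j → κ ^ k * (A i j * x j))
    ≈⟨ *-distribˡ-sum (κ ^ k) (λ j → A i j * x j) ⟨
  κ ^ k * (A *ᵥ x) i
    ≈⟨ *-congˡ (Ax≋κx i) ⟩
  κ ^ k * (κ * x i)
    ≈⟨ *-assoc (κ ^ k) κ (x i) ⟨
  κ ^ k * κ * x i
    ≈⟨ *-congʳ (*-comm (κ ^ k) κ) ⟩
  κ * κ ^ k * x i ∎
  where open ≃-Reasoning

-- The coefficient matrix c of the unit vectors in the basis is a right
-- inverse of the basis matrix by construction; linear independence makes
-- it a left inverse, so it can be moved cyclically under the trace.
module _ {n} {b : Fin n → Vector ℝ n} (isBasis : IsBasis b) where

  open ≃-Reasoning

  private
    c : Fin n → Vector ℝ n
    c i = proj₁ (proj₂ isBasis (1ᴹ i))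

    c-right : ∀ i → linearCombination (c i) b ≋ 1ᴹ i
    c-right i = proj₂ (proj₂ isBasis (1ᴹ i))

    c-left : ∀ k j → sum (λ i → b k i * c i j) ≃ 1ᴹ k j
    c-left k j = begin
      x                   ≈⟨ +-identityʳ x ⟨
      x + 0ℝ              ≈⟨ +-congˡ (-‿inverseˡ y) ⟨
      x + (- y + y)       ≈⟨ +-assoc x (- y) y ⟨
      (x - y) + y         ≈⟨ +-cong (proj₁ isBasis d d-zero j) ≃-refl ⟩
      0ℝ + y              ≈⟨ +-identityˡ y ⟩
      y                   ∎
      where
      x y : ℝ
      x = sum (λ i → b k i * c i j)
      y = 1ᴹ k j
      -- Reading `b` and `c` as matrices of row vectors, this is row `k` of `b c - 1`. As `c-right`
      -- says `c b = 1`, multiplying the row by `b` gives row `k` of `b (c b) - b = 0`, and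
      -- independence makes the row itself vanish.
      d : Vector ℝ n
      d j = sum (λ i → b k i * c i j) - 1ᴹ k j
      expand : ∀ l → sum (λ j → sum (λ i → b k i * c i j) * b j l) ≃ b k l
      expand l = begin
        sum (λ j → sum (λ i → b k i * c i j) * b j l)
          ≈⟨ sum-cong (λ j → *-distribʳ-sum (b j l) (λ i → b k i * c i j)) ⟩
        sum (λ j → sum (λ i → b k i * c i j * b j l))
          ≈⟨ ∑-comm (λ j i → b k i * c i j * b j l) ⟩
        sum (λ i → sum (λ j → b k i * c i j * b j l))
          ≈⟨ sum-cong (λ i → sum-cong λ j → *-assoc (b k i) (c i j) (b j l)) ⟩
        sum (λ i → sum (λ j → b k i * (c i j * b j l)))
          ≈⟨ sum-cong (λ i → *-distribˡ-sum (b k i) (λ j → c i j * b j l)) ⟨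
        sum (λ i → b k i * linearCombination (c i) b l)
          ≈⟨ sum-cong (λ i → *-congˡ (≃-trans (c-right i l) (1ᴹ-sym i l))) ⟩
        sum (λ i → b k i * 1ᴹ l i)
          ≈⟨ sum-cong (λ i → *-comm (b k i) (1ᴹ l i)) ⟩
        sum (λ i → 1ᴹ l i * b k i)
          ≈⟨ sum-1ᴹ l (b k) ⟩
        b k l ∎
      d-zero : linearCombination d b ≋ (λ _ → 0ℝ)
      d-zero l = begin
        sum (λ j → d j * b j l)
          ≈⟨ sum-cong (λ j → distribʳ (b j l) _ (- 1ᴹ k j)) ⟩
        sum (λ j → sum (λ i → b k i * c i j) * b j l + - 1ᴹ k j * b j l)
          ≈⟨ ∑-distrib-+ (λ j → sum (λ i → b k i * c i j) * b j l) (λ j → - 1ᴹ k j * b j l) ⟩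
        sum (λ j → sum (λ i → b k i * c i j) * b j l) + sum (λ j → - 1ᴹ k j * b j l)
          ≈⟨ +-cong (expand l) (sum-cong λ j →
               ≃-trans (*-congʳ (≃-sym (-1*x≈-x (1ᴹ k j)))) (*-assoc (- 1ℝ) (1ᴹ k j) (b j l))) ⟩
        b k l + sum (λ j → - 1ℝ * (1ᴹ k j * b j l))
          ≈⟨ +-congˡ (*-distribˡ-sum (- 1ℝ) (λ j → 1ᴹ k j * b j l)) ⟨
        b k l + - 1ℝ * sum (λ j → 1ᴹ k j * b j l)
          ≈⟨ +-congˡ (*-congˡ (sum-1ᴹ k (λ j → b j l))) ⟩
        b k l + - 1ℝ * b k l
          ≈⟨ +-congˡ (-1*x≈-x (b k l)) ⟩
        b k l + - b k l
          ≈⟨ -‿inverseʳ (b k l) ⟩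
        0ℝ ∎

  -- Inserting `c b = 1` into the diagonal of `A` makes `A` act on the basis vectors, which it
  -- scales by `κ j`; the factor left over is a diagonal entry of `b c = 1`.
  trace-eigenvalues : (A : Matrix n) (κ : Fin n → ℝ) →
    (∀ j → A *ᵥ b j ≋ κ j ·ᵥ b j) → trace A ≃ sum κ
  trace-eigenvalues A κ eigen = begin
    sum (λ i → A i i)
      ≈⟨ sum-cong (λ i → ≃-sym (sum-1ᴹ i (A i))) ⟩
    sum (λ i → sum (λ l → 1ᴹ i l * A i l))
      ≈⟨ sum-cong (λ i → sum-cong λ l → *-congʳ (c-right i l)) ⟨
    sum (λ i → sum (λ l → sum (λ j → c i j * b j l) * A i l))
      ≈⟨ sum-cong (λ i → sum-cong λ l → *-distribʳ-sum (A i l) (λ j → c i j * b j l)) ⟩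
    sum (λ i → sum (λ l → sum (λ j → c i j * b j l * A i l)))
      ≈⟨ sum-cong (λ i → ∑-comm (λ l j → c i j * b j l * A i l)) ⟩
    sum (λ i → sum (λ j → sum (λ l → c i j * b j l * A i l)))
      ≈⟨ sum-cong (λ i → sum-cong λ j → sum-cong λ l →
           ≃-trans (*-assoc (c i j) (b j l) (A i l)) (*-congˡ (*-comm (b j l) (A i l)))) ⟩
    sum (λ i → sum (λ j → sum (λ l → c i j * (A i l * b j l))))
      ≈⟨ sum-cong (λ i → sum-cong λ j → *-distribˡ-sum (c i j) (λ l → A i l * b j l)) ⟨
    sum (λ i → sum (λ j → c i j * (A *ᵥ b j) i))
      ≈⟨ sum-cong (λ i → sum-cong λ j → *-congˡ (eigen j i)) ⟩
    sum (λ i → sum (λ j → c i j * (κ j * b j i)))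
      ≈⟨ ∑-comm (λ i j → c i j * (κ j * b j i)) ⟩
    sum (λ j → sum (λ i → c i j * (κ j * b j i)))
      ≈⟨ sum-cong (λ j → sum-cong λ i →
           ≃-trans (*-comm (c i j) (κ j * b j i)) (*-assoc (κ j) (b j i) (c i j))) ⟩
    sum (λ j → sum (λ i → κ j * (b j i * c i j)))
      ≈⟨ sum-cong (λ j → *-distribˡ-sum (κ j) (λ i → b j i * c i j)) ⟨
    sum (λ j → κ j * sum (λ i → b j i * c i j))
      ≈⟨ sum-cong (λ j → *-congˡ (c-left j j)) ⟩
    sum (λ j → κ j * 1ᴹ j j)
      ≈⟨ sum-cong (λ j → ≃-trans (*-congˡ (if-cong (==-refl j))) (*-identityʳ (κ j))) ⟩
    sum κ ∎

-- Matrices whose entries depend only on the classes of the indices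

module Blowup {n m} (class : Fin n → Fin m) (size : Fin m → ℤ)
              (size≡ : ∀ a → size a ≡ sumℤ λ i → indicator (class i == a))
              (M : Fin m → Fin m → Bool) where

  open ≃-Reasoning

  -- Not a function, so that evaluating powers shares the entries.
  Table : Set
  Table = Vec (Vec ℤ m) m

  entry : Table → Fin m → Fin m → ℤ
  entry T a b = Vec.lookup (Vec.lookup T a) b

  tabulate² : (Fin m → Fin m → ℤ) → Table
  tabulate² f = Vec.tabulate λ a → Vec.tabulate (f a)

  entry-tabulate² : ∀ f a b → entry (tabulate² f) a b ≡ f a b
  entry-tabulate² f a b = ≡.trans
    (cong (λ r → Vec.lookup r b) (Vec.lookup∘tabulate (λ a → Vec.tabulate (f a)) a))
    (Vec.lookup∘tabulate (f a) b)

  multiply : Table → Table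
  multiply T = tabulate² λ a b → sumℤ λ c →
    size c ℤ.* (indicator (M a c) ℤ.* entry T c b)

  -- The classwise entries of the (k + 1)-st power of the blow-up.
  powerTable : ℕ → Table
  powerTable ℕ.zero    = tabulate² λ a b → indicator (M a b)
  powerTable (ℕ.suc k) = multiply (powerTable k)

  -- The identity matrix is in general not constant on classes, so the zeroth power has a case of
  -- its own and the tables start at the first power.
  powerTrace : ℕ → ℤ
  powerTrace ℕ.zero    = sumℤ {n} λ _ → + 1
  powerTrace (ℕ.suc k) = sumℤ λ a → size a ℤ.* entry (powerTable k) a a

  blowup : Matrix n
  blowup i j = ι (indicator (M (class i) (class j)))

  -- This collapses the inner sum of a matrix product, and likewise the trace, to a sum over classes
  -- weighted by their sizes.
  sum-classes : (f : Fin m → ℝ) →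
    sum (λ i → f (class i)) ≃ sum (λ a → ι (size a) * f a)
  sum-classes f = begin
    sum (λ i → f (class i))
      ≈⟨ sum-cong (λ i → sum-1ᴹ (class i) f) ⟨
    sum (λ i → sum (λ a → 1ᴹ (class i) a * f a))
      ≈⟨ ∑-comm (λ i a → 1ᴹ (class i) a * f a) ⟩
    sum (λ a → sum (λ i → 1ᴹ (class i) a * f a))
      ≈⟨ sum-cong (λ a → *-distribʳ-sum (f a) (λ i → 1ᴹ (class i) a)) ⟨
    sum (λ a → sum (λ i → 1ᴹ (class i) a) * f a)
      ≈⟨ sum-cong (λ a → *-congʳ (count a)) ⟨
    sum (λ a → ι (size a) * f a) ∎
    where
    count : ∀ a → ι (size a) ≃ sum (λ i → 1ᴹ (class i) a)
    count a = begin
      ι (size a)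
        ≡⟨ cong ι (size≡ a) ⟩
      ι (sumℤ λ i → indicator (class i == a))
        ≈⟨ ι-sum (λ i → indicator (class i == a)) ⟩
      sum (λ i → ι (indicator (class i == a)))
        ≈⟨ sum-cong (λ i → ιindicator≃ (class i == a)) ⟩
      sum (λ i → 1ᴹ (class i) a) ∎

  blowup-power : ∀ k i j →
    (blowup ^ᴹ ℕ.suc k) i j ≃ ι (entry (powerTable k) (class i) (class j))
  blowup-power ℕ.zero i j = begin
    sum (λ l → blowup i l * 1ᴹ l j)
      ≈⟨ sum-cong (λ l → ≃-trans (*-comm (blowup i l) (1ᴹ l j)) (*-congʳ (1ᴹ-sym l j))) ⟩
    sum (λ l → 1ᴹ j l * blowup i l)
      ≈⟨ sum-1ᴹ j (blowup i) ⟩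
    blowup i j
      ≡⟨ cong ι (entry-tabulate² (λ a b → indicator (M a b)) (class i) (class j)) ⟨
    ι (entry (powerTable 0) (class i) (class j)) ∎
  blowup-power (ℕ.suc k) i j = begin
    sum (λ l → blowup i l * (blowup ^ᴹ ℕ.suc k) l j)
      ≈⟨ sum-cong (λ l → *-congˡ (blowup-power k l j)) ⟩
    sum (λ l → blowup i l * ι (entry (powerTable k) (class l) (class j)))
      ≈⟨ sum-classes (λ c → ι (indicator (M (class i) c)) * ι (entry (powerTable k) c (class j))) ⟩
    sum (λ c → ι (size c)
               * (ι (indicator (M (class i) c)) * ι (entry (powerTable k) c (class j))))
      ≈⟨ sum-cong (λ c → ≃-trans (ι-* (size c) _) (*-congˡ (ι-* (indicator (M (class i) c)) _))) ⟨
    sum (λ c → ι (product (class i) (class j) c))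
      ≈⟨ ι-sum (product (class i) (class j)) ⟨
    ι (sumℤ (product (class i) (class j)))
      ≡⟨ cong ι (entry-tabulate² (λ a b → sumℤ (product a b)) (class i) (class j)) ⟨
    ι (entry (powerTable (ℕ.suc k)) (class i) (class j)) ∎
    where
    product : Fin m → Fin m → Fin m → ℤ
    product a b c = size c ℤ.* (indicator (M a c) ℤ.* entry (powerTable k) c b)

  trace-blowup : ∀ k → trace (blowup ^ᴹ k) ≃ ι (powerTrace k)
  trace-blowup ℕ.zero = ≃-trans
    (sum-cong {n} λ i → if-cong (==-refl i)) (≃-sym (ι-sum {n} λ _ → + 1))
  trace-blowup (ℕ.suc k) = begin
    sum (λ i → (blowup ^ᴹ ℕ.suc k) i i)
      ≈⟨ sum-cong (λ i → blowup-power k i i) ⟩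
    sum (λ i → ι (entry (powerTable k) (class i) (class i)))
      ≈⟨ sum-classes (λ a → ι (entry (powerTable k) a a)) ⟩
    sum (λ a → ι (size a) * ι (entry (powerTable k) a a))
      ≈⟨ sum-cong (λ a → ι-* (size a) (entry (powerTable k) a a)) ⟨
    sum (λ a → ι (size a ℤ.* entry (powerTable k) a a))
      ≈⟨ ι-sum (λ a → size a ℤ.* entry (powerTable k) a a) ⟨
    ι (powerTrace (ℕ.suc k)) ∎

-- Approximating t₊⁴

0≤p*q : ∀ {p q} → 0ℚ ℚ.≤ p → 0ℚ ℚ.≤ q → 0ℚ ℚ.≤ p ℚ.* q
0≤p*q {p} {q} 0≤p 0≤q = ℚ.nonNegative⁻¹ (p ℚ.* q)
  {{ℚ.nonNeg*nonNeg⇒nonNeg p {{ℚ.nonNegative 0≤p}} q {{ℚ.nonNegative 0≤q}}}}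

∣p∣²≡p² : ∀ p → ∣ p ∣ ℚ.* ∣ p ∣ ≡ p ℚ.* p
∣p∣²≡p² p with ℚ.∣p∣≡p∨∣p∣≡-p p
... | inj₁ ∣p∣≡p  = cong₂ ℚ._*_ ∣p∣≡p ∣p∣≡p
... | inj₂ ∣p∣≡-p = ≡.trans (cong₂ ℚ._*_ ∣p∣≡-p ∣p∣≡-p)
                      (solve 1 (λ p → (:- p) :* (:- p) := p :* p) ≡.refl p)

0≤p² : ∀ p → 0ℚ ℚ.≤ p ℚ.* p
0≤p² p = ≡.subst (0ℚ ℚ.≤_) (∣p∣²≡p² p) (0≤p*q (ℚ.0≤∣p∣ p) (ℚ.0≤∣p∣ p))

p²≤q²⇒∣p∣≤q : ∀ {p q} → 0ℚ ℚ.≤ q → p ℚ.* p ℚ.≤ q ℚ.* q → ∣ p ∣ ℚ.≤ q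
p²≤q²⇒∣p∣≤q {p} {q} 0≤q p²≤q² = ℚ.≮⇒≥ λ q<∣p∣ → ℚ.<-irrefl ≡.refl (begin-strict
  q ℚ.* q          ≤⟨ ℚ.*-monoˡ-≤-nonNeg q {{ℚ.nonNegative 0≤q}} (ℚ.<⇒≤ q<∣p∣) ⟩
  q ℚ.* ∣ p ∣      <⟨ ℚ.*-monoˡ-<-pos ∣ p ∣ {{ℚ.positive (ℚ.≤-<-trans 0≤q q<∣p∣)}} q<∣p∣ ⟩
  ∣ p ∣ ℚ.* ∣ p ∣  ≡⟨ ∣p∣²≡p² p ⟩
  p ℚ.* p          ≤⟨ p²≤q² ⟩
  q ℚ.* q          ∎)
  where open ℚ.≤-Reasoning

-- For nonnegative `p` and `q`, `∣p - q∣ ≤ p + q`, hence `(p - q)² ≤ ∣p² - q²∣ ≤ r²`. This replaces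
-- the extraction of square roots.
sqrt-close : ∀ {p q r} → 0ℚ ℚ.≤ p → 0ℚ ℚ.≤ q → 0ℚ ℚ.≤ r →
             ∣ p ℚ.* p ℚ.- q ℚ.* q ∣ ℚ.≤ r ℚ.* r → ∣ p ℚ.- q ∣ ℚ.≤ r
sqrt-close {p} {q} {r} 0≤p 0≤q 0≤r close = p²≤q²⇒∣p∣≤q 0≤r (begin
  (p ℚ.- q) ℚ.* (p ℚ.- q)
    ≡⟨ ∣p∣²≡p² (p ℚ.- q) ⟨
  ∣ p ℚ.- q ∣ ℚ.* ∣ p ℚ.- q ∣
    ≤⟨ ℚ.*-monoˡ-≤-nonNeg ∣ p ℚ.- q ∣ {{ℚ.∣-∣-nonNeg (p ℚ.- q)}} ∣p-q∣≤p+q ⟩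
  ∣ p ℚ.- q ∣ ℚ.* (p ℚ.+ q)
    ≡⟨ cong (∣ p ℚ.- q ∣ ℚ.*_) (ℚ.0≤p⇒∣p∣≡p (ℚ.+-mono-≤ 0≤p 0≤q)) ⟨
  ∣ p ℚ.- q ∣ ℚ.* ∣ p ℚ.+ q ∣
    ≡⟨ ℚ.∣p*q∣≡∣p∣*∣q∣ (p ℚ.- q) (p ℚ.+ q) ⟨
  ∣ (p ℚ.- q) ℚ.* (p ℚ.+ q) ∣
    ≡⟨ cong ∣_∣ (solve 2 (λ p q → (p :- q) :* (p :+ q) := p :* p :- q :* q) ≡.refl p q) ⟩
  ∣ p ℚ.* p ℚ.- q ℚ.* q ∣
    ≤⟨ close ⟩
  r ℚ.* r ∎)
  where
  open ℚ.≤-Reasoning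
  ∣p-q∣≤p+q : ∣ p ℚ.- q ∣ ℚ.≤ p ℚ.+ q
  ∣p-q∣≤p+q = ≡.subst (∣ p ℚ.- q ∣ ℚ.≤_)
    (cong₂ ℚ._+_ (ℚ.0≤p⇒∣p∣≡p 0≤p) (ℚ.0≤p⇒∣p∣≡p 0≤q)) (ℚ.∣p-q∣≤∣p∣+∣q∣ p q)

∣sum∣≤ : ∀ {m} (f : Vector ℚ m) {B} → (∀ i → ∣ f i ∣ ℚ.≤ B) →
         ∣ sumℚ f ∣ ℚ.≤ sumℚ {m} (λ _ → B)
∣sum∣≤ {ℕ.zero}  f f≤B = ℚ.≤-refl
∣sum∣≤ {ℕ.suc m} f f≤B = ℚ.≤-trans (ℚ.∣p+q∣≤∣p∣+∣q∣ (f zero) (sumℚ (f ∘ suc)))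
  (ℚ.+-mono-≤ (f≤B zero) (∣sum∣≤ (f ∘ suc) (f≤B ∘ suc)))

0≤sum : ∀ {m} (f : Vector ℚ m) → (∀ i → 0ℚ ℚ.≤ f i) → 0ℚ ℚ.≤ sumℚ f
0≤sum {ℕ.zero}  f 0≤f = ℚ.≤-refl
0≤sum {ℕ.suc m} f 0≤f = ℚ.+-mono-≤ (0≤f zero) (0≤sum (f ∘ suc) (0≤f ∘ suc))

term≤sum : ∀ {m} (f : Vector ℚ m) → (∀ i → 0ℚ ℚ.≤ f i) → ∀ i → f i ℚ.≤ sumℚ f
term≤sum f 0≤f zero    = ≡.subst (ℚ._≤ sumℚ f) (ℚ.+-identityʳ (f zero))
  (ℚ.+-monoʳ-≤ (f zero) (0≤sum (f ∘ suc) (0≤f ∘ suc)))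
term≤sum f 0≤f (suc i) = ≡.subst (ℚ._≤ sumℚ f) (ℚ.+-identityˡ (f (suc i)))
  (ℚ.+-mono-≤ (0≤f zero) (term≤sum (f ∘ suc) (0≤f ∘ suc) i))

-- The form to which the terms of `x ^ 4` unfold, trailing 1 included, so that
-- `eventually-positivePart⁴` can close with `refl`.
fourth-power : ℚ → ℚ
fourth-power t = t ℚ.* (t ℚ.* (t ℚ.* (t ℚ.* 1ℚ)))

-- Here t approximates a real whose positivity is decided; a real that is not
-- positive may still have slightly positive approximations.
PositivePart⁴ : (ε t g : ℚ) → Set
PositivePart⁴ ε t g = (0ℚ ℚ.≤ t × g ≡ fourth-power t) ⊎ (t ℚ.≤ ε × g ≡ 0ℚ)

-- When w ≈ D ∣t∣, the positive part of t is (D t + w) / 2 D.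
positivePart⁴-close : ∀ {D η R ε} t w g →
  0ℚ ℚ.≤ D → 0ℚ ℚ.≤ η → 0ℚ ℚ.≤ R → D ℚ.* (ε ℚ.+ ε) ℚ.≤ η →
  0ℚ ℚ.≤ w → t ℚ.* t ℚ.≤ R ℚ.* R →
  (w ℚ.* w ℚ.- (D ℚ.* t) ℚ.* (D ℚ.* t)) ℚ.* (w ℚ.* w ℚ.- (D ℚ.* t) ℚ.* (D ℚ.* t))
    ℚ.≤ (η ℚ.* η) ℚ.* (η ℚ.* η) →
  PositivePart⁴ ε t g →
  ∣ (D ℚ.+ D) ℚ.* g ℚ.- t ℚ.* (t ℚ.* t) ℚ.* (D ℚ.* t ℚ.+ w) ∣ ℚ.≤ R ℚ.* (R ℚ.* R) ℚ.* (η ℚ.+ η)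
positivePart⁴-close {D} {η} {R} {ε} t w g 0≤D 0≤η 0≤R Dε≤η 0≤w t²≤R² w²≈ = go
  where
  open ℚ.≤-Reasoning

  ∣t∣≤R : ∣ t ∣ ℚ.≤ R
  ∣t∣≤R = p²≤q²⇒∣p∣≤q 0≤R t²≤R²

  0≤∣t∣ : 0ℚ ℚ.≤ ∣ t ∣
  0≤∣t∣ = ℚ.0≤∣p∣ t

  -- Two roots are taken: `η⁴` bounds the square of `w² - D² t²`, so `η²` bounds its absolute value,
  -- so `η` bounds the distance from `w` to `D ∣t∣`.
  w≈D∣t∣ : ∣ w ℚ.- D ℚ.* ∣ t ∣ ∣ ℚ.≤ η
  w≈D∣t∣ = sqrt-close 0≤w (0≤p*q 0≤D 0≤∣t∣) 0≤η
    (≡.subst (λ q → ∣ w ℚ.* w ℚ.- q ∣ ℚ.≤ η ℚ.* η) D²t²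
      (p²≤q²⇒∣p∣≤q (0≤p² η) w²≈))
    where
    D²t² : (D ℚ.* t) ℚ.* (D ℚ.* t) ≡ (D ℚ.* ∣ t ∣) ℚ.* (D ℚ.* ∣ t ∣)
    D²t² = ≡.trans (sq D t) (≡.trans (cong (D ℚ.* D ℚ.*_) (≡.sym (∣p∣²≡p² t))) (≡.sym (sq D ∣ t ∣)))
      where
      sq : ∀ a b → (a ℚ.* b) ℚ.* (a ℚ.* b) ≡ a ℚ.* a ℚ.* (b ℚ.* b)
      sq = solve 2 (λ a b → (a :* b) :* (a :* b) := a :* a :* (b :* b)) ≡.refl

  η≤2η : η ℚ.≤ η ℚ.+ η
  η≤2η = ≡.subst (ℚ._≤ η ℚ.+ η) (ℚ.+-identityʳ η) (ℚ.+-monoʳ-≤ η 0≤η)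

  -- In both cases of `PositivePart⁴` the difference to be bounded is `- t³ x`, with `x = w - D t`
  -- in the first and `x = w + D t` in the second.
  finish : ∀ x → ∣ x ∣ ℚ.≤ η ℚ.+ η →
           ∣ t ℚ.* (t ℚ.* t) ℚ.* x ∣ ℚ.≤ R ℚ.* (R ℚ.* R) ℚ.* (η ℚ.+ η)
  finish x ∣x∣≤2η = ≡.subst (ℚ._≤ R ℚ.* (R ℚ.* R) ℚ.* (η ℚ.+ η)) (≡.sym abs)
    (*-mono-≤-nonNeg (0≤p*q 0≤R (0≤p*q 0≤R 0≤R)) (ℚ.0≤∣p∣ x)
      (*-mono-≤-nonNeg 0≤R (0≤p*q 0≤∣t∣ 0≤∣t∣) ∣t∣≤R
        (*-mono-≤-nonNeg 0≤R 0≤∣t∣ ∣t∣≤R ∣t∣≤R))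
      ∣x∣≤2η)
    where
    abs : ∣ t ℚ.* (t ℚ.* t) ℚ.* x ∣ ≡ ∣ t ∣ ℚ.* (∣ t ∣ ℚ.* ∣ t ∣) ℚ.* ∣ x ∣
    abs = ≡.trans (ℚ.∣p*q∣≡∣p∣*∣q∣ (t ℚ.* (t ℚ.* t)) x) (cong (ℚ._* ∣ x ∣)
      (≡.trans (ℚ.∣p*q∣≡∣p∣*∣q∣ t (t ℚ.* t)) (cong (∣ t ∣ ℚ.*_) (ℚ.∣p*q∣≡∣p∣*∣q∣ t t))))

  w≈-Dt : t ℚ.≤ ε → ∣ w ℚ.+ D ℚ.* t ∣ ℚ.≤ η ℚ.+ η
  w≈-Dt t≤ε with ℚ.∣p∣≡p∨∣p∣≡-p t
  ... | inj₂ ∣t∣≡-t = ℚ.≤-trans (≡.subst (λ q → ∣ q ∣ ℚ.≤ η)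
          (≡.trans (cong (λ q → w ℚ.- D ℚ.* q) ∣t∣≡-t)
            (solve 3 (λ w D t → w :- D :* (:- t) := w :+ D :* t) ≡.refl w D t))
          w≈D∣t∣) η≤2η
  -- Here `0 ≤ t ≤ ε`: treating `t` as nonpositive costs an extra `2 D t ≤ η`, which is where the
  -- second `η` of the bound is spent.
  ... | inj₁ ∣t∣≡t = begin
    ∣ w ℚ.+ D ℚ.* t ∣
      ≡⟨ cong ∣_∣ (solve 3 (λ w D t → w :+ D :* t := (w :- D :* t) :+ D :* (t :+ t)) ≡.refl w D t) ⟩
    ∣ (w ℚ.- D ℚ.* t) ℚ.+ D ℚ.* (t ℚ.+ t) ∣
      ≤⟨ ℚ.∣p+q∣≤∣p∣+∣q∣ (w ℚ.- D ℚ.* t) (D ℚ.* (t ℚ.+ t)) ⟩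
    ∣ w ℚ.- D ℚ.* t ∣ ℚ.+ ∣ D ℚ.* (t ℚ.+ t) ∣
      ≤⟨ ℚ.+-mono-≤ (≡.subst (λ q → ∣ w ℚ.- D ℚ.* q ∣ ℚ.≤ η) ∣t∣≡t w≈D∣t∣) small ⟩
    η ℚ.+ η ∎
    where
    0≤t : 0ℚ ℚ.≤ t
    0≤t = ℚ.∣p∣≡p⇒0≤p ∣t∣≡t
    small : ∣ D ℚ.* (t ℚ.+ t) ∣ ℚ.≤ η
    small = begin
      ∣ D ℚ.* (t ℚ.+ t) ∣ ≡⟨ ℚ.0≤p⇒∣p∣≡p (0≤p*q 0≤D (ℚ.+-mono-≤ 0≤t 0≤t)) ⟩
      D ℚ.* (t ℚ.+ t)     ≤⟨ ℚ.*-monoˡ-≤-nonNeg D {{ℚ.nonNegative 0≤D}} (ℚ.+-mono-≤ t≤ε t≤ε) ⟩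
      D ℚ.* (ε ℚ.+ ε)     ≤⟨ Dε≤η ⟩
      η                   ∎

  go : PositivePart⁴ ε t g →
       ∣ (D ℚ.+ D) ℚ.* g ℚ.- t ℚ.* (t ℚ.* t) ℚ.* (D ℚ.* t ℚ.+ w) ∣ ℚ.≤ R ℚ.* (R ℚ.* R) ℚ.* (η ℚ.+ η)
  go (inj₁ (0≤t , ≡.refl)) = ≡.subst (ℚ._≤ R ℚ.* (R ℚ.* R) ℚ.* (η ℚ.+ η))
    (≡.trans (≡.sym (ℚ.∣-p∣≡∣p∣ _)) (cong ∣_∣ (solve 3 (λ D t w →
      :- (t :* (t :* t) :* (w :- D :* t))
        := (D :+ D) :* (t :* (t :* (t :* (t :* con 1ℚ)))) :- t :* (t :* t) :* (D :* t :+ w)) ≡.refl D t w)))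
    (finish (w ℚ.- D ℚ.* t)
      (ℚ.≤-trans (≡.subst (λ q → ∣ w ℚ.- D ℚ.* q ∣ ℚ.≤ η) (ℚ.0≤p⇒∣p∣≡p 0≤t) w≈D∣t∣) η≤2η))
  go (inj₂ (t≤ε , ≡.refl)) = ≡.subst (ℚ._≤ R ℚ.* (R ℚ.* R) ℚ.* (η ℚ.+ η))
    (≡.trans (≡.sym (ℚ.∣-p∣≡∣p∣ _)) (cong ∣_∣ (solve 3 (λ D t w →
      :- (t :* (t :* t) :* (w :+ D :* t))
        := (D :+ D) :* con 0ℚ :- t :* (t :* t) :* (D :* t :+ w)) ≡.refl D t w)))
    (finish (w ℚ.+ D ℚ.* t) (w≈-Dt t≤ε))

-- Integer polynomials

infixl 6 _⊕_
infixl 7 _⊗_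
infixr 7 _·_

-- Coefficients in order of increasing degree.
Poly : Set
Poly = List ℤ

_⊕_ : Poly → Poly → Poly
[]      ⊕ q       = q
(a ∷ p) ⊕ []      = a ∷ p
(a ∷ p) ⊕ (b ∷ q) = a ℤ.+ b ∷ p ⊕ q

_·_ : ℤ → Poly → Poly
c · []      = []
c · (a ∷ p) = c ℤ.* a ∷ c · p

_⊗_ : Poly → Poly → Poly
[]      ⊗ q = []
(a ∷ p) ⊗ q = a · q ⊕ (+ 0 ∷ p ⊗ q)

-- The linear functional sending the `k`-th power of the variable to `τ k`. When `τ` lists the power
-- sums of the `κ j`, it gives the sum of `p (κ j)` over all `j`.
moment : (ℕ → ℤ) → Poly → ℤ
moment τ []      = + 0
moment τ (a ∷ p) = a ℤ.* τ 0 ℤ.+ moment (τ ∘ ℕ.suc) p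

-- The variable stands for `κ`, so this polynomial is the adjacency eigenvalue `λ`.
X-1 : Poly
X-1 = -[1+ 0 ] ∷ + 1 ∷ []

square cube : Poly → Poly
square p = p ⊗ p
cube p = p ⊗ square p

-- With `λ = κ - 1`, `defect` is `S⁴ - D² λ²`, which for `D ≥ 0` vanishes exactly where
-- `S² = D ∣λ∣`. There `energy`, which is `λ³ (D λ + S²)`, equals `2 D λ₊⁴`.
defect energy : ℤ → Poly → Poly
defect D S = square (square S) ⊕ (ℤ.- + 1) · square (D · X-1)
energy D S = cube X-1 ⊗ (D · X-1 ⊕ square S)

⟦_⟧ : Poly → ℚ → ℚ
⟦ [] ⟧    x = 0ℚ
⟦ a ∷ p ⟧ x = fromℤ a ℚ.+ x ℚ.* ⟦ p ⟧ x

⟦⊕⟧ : ∀ p q x → ⟦ p ⊕ q ⟧ x ≡ ⟦ p ⟧ x ℚ.+ ⟦ q ⟧ x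
⟦⊕⟧ []      q       x = ≡.sym (ℚ.+-identityˡ (⟦ q ⟧ x))
⟦⊕⟧ (a ∷ p) []      x = ≡.sym (ℚ.+-identityʳ (⟦ a ∷ p ⟧ x))
⟦⊕⟧ (a ∷ p) (b ∷ q) x = ≡.trans
  (cong₂ (λ c r → c ℚ.+ x ℚ.* r) (fromℤ-+ a b) (⟦⊕⟧ p q x))
  (solve 5 (λ a b x p q → a :+ b :+ x :* (p :+ q) := a :+ x :* p :+ (b :+ x :* q)) ≡.refl
    (fromℤ a) (fromℤ b) x (⟦ p ⟧ x) (⟦ q ⟧ x))

⟦·⟧ : ∀ c p x → ⟦ c · p ⟧ x ≡ fromℤ c ℚ.* ⟦ p ⟧ x
⟦·⟧ c []      x = ≡.sym (ℚ.*-zeroʳ (fromℤ c))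
⟦·⟧ c (a ∷ p) x = ≡.trans
  (cong₂ (λ b r → b ℚ.+ x ℚ.* r) (fromℤ-* c a) (⟦·⟧ c p x))
  (solve 4 (λ c a x p → c :* a :+ x :* (c :* p) := c :* (a :+ x :* p)) ≡.refl
    (fromℤ c) (fromℤ a) x (⟦ p ⟧ x))

⟦⊗⟧ : ∀ p q x → ⟦ p ⊗ q ⟧ x ≡ ⟦ p ⟧ x ℚ.* ⟦ q ⟧ x
⟦⊗⟧ []      q x = ≡.sym (ℚ.*-zeroˡ (⟦ q ⟧ x))
⟦⊗⟧ (a ∷ p) q x = ≡.trans (⟦⊕⟧ (a · q) (+ 0 ∷ p ⊗ q) x) (≡.trans
  (cong₂ (λ r s → r ℚ.+ (0ℚ ℚ.+ x ℚ.* s)) (⟦·⟧ a q x) (⟦⊗⟧ p q x))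
  (solve 4 (λ a x p q → a :* q :+ (con 0ℚ :+ x :* (p :* q)) := (a :+ x :* p) :* q) ≡.refl
    (fromℤ a) x (⟦ p ⟧ x) (⟦ q ⟧ x)))

⟦X-1⟧ : ∀ l → ⟦ X-1 ⟧ (l ℚ.+ 1ℚ) ≡ l
⟦X-1⟧ l = solve 1 (λ l → con (ℚ.- 1ℚ) :+ (l :+ con 1ℚ) :* (con 1ℚ :+ (l :+ con 1ℚ) :* con 0ℚ) := l) ≡.refl l

-1*p≡-p : ∀ p → fromℤ (ℤ.- + 1) ℚ.* p ≡ ℚ.- p
-1*p≡-p p = solve 1 (λ p → con (ℚ.- 1ℚ) :* p := :- p) ≡.refl p

⟦defect⟧ : ∀ D S {x l} → ⟦ X-1 ⟧ x ≡ l →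
  ⟦ defect D S ⟧ x ≡ ⟦ square S ⟧ x ℚ.* ⟦ square S ⟧ x ℚ.- (fromℤ D ℚ.* l) ℚ.* (fromℤ D ℚ.* l)
⟦defect⟧ D S {x} {l} t≡l = ≡.trans (⟦⊕⟧ (square (square S)) ((ℤ.- + 1) · square (D · X-1)) x)
  (cong₂ ℚ._+_ (⟦⊗⟧ (square S) (square S) x)
    (≡.trans (⟦·⟧ (ℤ.- + 1) (square (D · X-1)) x)
      (≡.trans (-1*p≡-p _) (cong ℚ.-_ (≡.trans (⟦⊗⟧ (D · X-1) (D · X-1) x)
        (cong₂ ℚ._*_ Dl Dl))))))
  where
  Dl : ⟦ D · X-1 ⟧ x ≡ fromℤ D ℚ.* l
  Dl = ≡.trans (⟦·⟧ D X-1 x) (cong (fromℤ D ℚ.*_) t≡l)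

⟦energy⟧ : ∀ D S {x l} → ⟦ X-1 ⟧ x ≡ l →
  ⟦ energy D S ⟧ x ≡ l ℚ.* (l ℚ.* l) ℚ.* (fromℤ D ℚ.* l ℚ.+ ⟦ square S ⟧ x)
⟦energy⟧ D S {x} {l} t≡l = ≡.trans (⟦⊗⟧ (cube X-1) (D · X-1 ⊕ square S) x)
  (cong₂ ℚ._*_
    (≡.trans (⟦⊗⟧ X-1 (square X-1) x) (cong₂ ℚ._*_ t≡l (≡.trans (⟦⊗⟧ X-1 X-1 x) (cong₂ ℚ._*_ t≡l t≡l))))
    (≡.trans (⟦⊕⟧ (D · X-1) (square S) x)
      (cong (ℚ._+ ⟦ square S ⟧ x) (≡.trans (⟦·⟧ D X-1 x) (cong (fromℤ D ℚ.*_) t≡l)))))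

-- Trace identities hold between reals, whereas the estimates concern rational terms of their
-- sequences. The same Horner scheme on both sides makes the two evaluations agree term by term.
evalℝ : Poly → ℝ → ℝ
evalℝ []      x = 0ℝ
evalℝ (a ∷ p) x = ι a + x * evalℝ p x

seq-evalℝ : ∀ p x n → seq (evalℝ p x) n ≡ ⟦ p ⟧ (seq x n)
seq-evalℝ []      x n = ≡.refl
seq-evalℝ (a ∷ p) x n = cong (λ r → fromℤ a ℚ.+ seq x n ℚ.* r) (seq-evalℝ p x n)

seq-sum : ∀ {m} (f : Vector ℝ m) n → seq (sum f) n ≡ sumℚ (λ j → seq (f j) n)
seq-sum {ℕ.zero}  f n = ≡.refl
seq-sum {ℕ.suc m} f n = cong (seq (f zero) n ℚ.+_) (seq-sum (f ∘ suc) n)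

sum-const : ∀ n b → sumℚ {n} (λ _ → fromℤ b) ≡ fromℤ (+ n ℤ.* b)
sum-const ℕ.zero    b = cong fromℤ (≡.sym (ℤ.*-zeroˡ b))
sum-const (ℕ.suc n) b = ≡.trans (cong (fromℤ b ℚ.+_) (sum-const n b))
  (≡.trans (≡.sym (fromℤ-+ b (+ n ℤ.* b))) (cong fromℤ (≡.sym (ℤ.suc-* (+ n) b))))

-- The weights `w` carry the induction: passing to the tail of `p` absorbs a factor `κ j` into `w j`
-- and shifts `τ` by one.
moment-sum : ∀ {m} (κ : Vector ℝ m) p (w : Vector ℝ m) τ →
  (∀ k → sum (λ j → w j * κ j ^ k) ≃ ι (τ k)) →
  sum (λ j → w j * evalℝ p (κ j)) ≃ ι (moment τ p)
moment-sum {m} κ []      w τ powers = begin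
  sum (λ j → w j * 0ℝ)  ≈⟨ sum-cong (λ j → zeroʳ (w j)) ⟩
  sum {m} (λ _ → 0ℝ)    ≈⟨ sum-replicate-zero m ⟩
  0ℝ                    ≈⟨ ≗⇒≃ (λ _ → ≡.refl) ⟩
  ι (+ 0)               ∎
  where open ≃-Reasoning
moment-sum κ (a ∷ p) w τ powers = begin
  sum (λ j → w j * (ι a + κ j * evalℝ p (κ j)))
    ≈⟨ sum-cong (λ j → ≃-trans (distribˡ (w j) (ι a) (κ j * evalℝ p (κ j)))
         (+-cong (≃-trans (*-comm (w j) (ι a)) (*-congˡ (≃-sym (*-identityʳ (w j)))))
                 (≃-sym (*-assoc (w j) (κ j) (evalℝ p (κ j)))))) ⟩
  sum (λ j → ι a * (w j * κ j ^ 0) + w j * κ j * evalℝ p (κ j))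
    ≈⟨ ∑-distrib-+ (λ j → ι a * (w j * κ j ^ 0)) (λ j → w j * κ j * evalℝ p (κ j)) ⟩
  sum (λ j → ι a * (w j * κ j ^ 0)) + sum (λ j → w j * κ j * evalℝ p (κ j))
    ≈⟨ +-cong (≃-sym (*-distribˡ-sum (ι a) (λ j → w j * κ j ^ 0)))
         (moment-sum κ p (λ j → w j * κ j) (τ ∘ ℕ.suc) (λ k →
           ≃-trans (sum-cong λ j → *-assoc (w j) (κ j) (κ j ^ k)) (powers (ℕ.suc k)))) ⟩
  ι a * sum (λ j → w j * κ j ^ 0) + ι (moment (τ ∘ ℕ.suc) p)
    ≈⟨ +-cong (≃-trans (*-congˡ (powers 0)) (≃-sym (ι-* a (τ 0)))) ≃-refl ⟩
  ι (a ℤ.* τ 0) + ι (moment (τ ∘ ℕ.suc) p)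
    ≈⟨ ι-+ (a ℤ.* τ 0) (moment (τ ∘ ℕ.suc) p) ⟨
  ι (moment τ (a ∷ p)) ∎
  where open ≃-Reasoning

-- Eventual estimates for the terms of a real

p≤∣p∣ : ∀ p → p ℚ.≤ ∣ p ∣
p≤∣p∣ p with ℚ.∣p∣≡p∨∣p∣≡-p p
... | inj₁ ∣p∣≡p  = ℚ.≤-reflexive (≡.sym ∣p∣≡p)
... | inj₂ ∣p∣≡-p = ℚ.≤-trans p≤0 (ℚ.0≤∣p∣ p)
  where
  p≤0 : p ℚ.≤ 0ℚ
  p≤0 = ≡.subst (ℚ._≤ 0ℚ) (≡.trans (cong ℚ.-_ ∣p∣≡-p) (solve 1 (λ p → :- (:- p) := p) ≡.refl p))
          (ℚ.neg-antimono-≤ (ℚ.0≤∣p∣ p))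

∣p-q∣≤r⇒p≤q+r : ∀ {p q r} → ∣ p ℚ.- q ∣ ℚ.≤ r → p ℚ.≤ q ℚ.+ r
∣p-q∣≤r⇒p≤q+r {p} {q} {r} close = ≡.subst (ℚ._≤ q ℚ.+ r)
  (solve 2 (λ p q → q :+ (p :- q) := p) ≡.refl p q)
  (ℚ.+-monoʳ-≤ q (ℚ.≤-trans (p≤∣p∣ (p ℚ.- q)) close))

∣p-q∣≡∣q-p∣ : ∀ p q → ∣ p ℚ.- q ∣ ≡ ∣ q ℚ.- p ∣
∣p-q∣≡∣q-p∣ p q = ≡.trans (≡.sym (ℚ.∣-p∣≡∣p∣ (p ℚ.- q)))
  (cong ∣_∣ (solve 2 (λ p q → :- (p :- q) := q :- p) ≡.refl p q))

∣p-q∣-trans : ∀ p q r {a b} → ∣ p ℚ.- q ∣ ℚ.≤ a → ∣ q ℚ.- r ∣ ℚ.≤ b → ∣ p ℚ.- r ∣ ℚ.≤ a ℚ.+ b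
∣p-q∣-trans p q r {a} {b} p≈q q≈r = ≡.subst (ℚ._≤ a ℚ.+ b)
  (cong ∣_∣ (solve 3 (λ p q r → (p :- q) :+ (q :- r) := p :- r) ≡.refl p q r))
  (ℚ.≤-trans (ℚ.∣p+q∣≤∣p∣+∣q∣ (p ℚ.- q) (q ℚ.- r)) (ℚ.+-mono-≤ p≈q q≈r))

-- Past the Cauchy threshold for `ε / 2`, a single term above `ε` would keep all later terms above
-- `ε / 2` and so witness `0ℝ < x`.
≮0⇒eventually≤ : ∀ {x} → ¬ (0ℝ < x) → ∀ ε → 0ℚ ℚ.< ε → Eventually (λ n → seq x n ℚ.≤ ε)
≮0⇒eventually≤ {x} x≯0 ε 0<ε =
  let N , close = cauchy x (½ ℚ.* ε) 0<½ε
  in N , λ n N≤n → ℚ.≮⇒≥ λ ε<xₙ → x≯0 (mk< (½ ℚ.* ε) 0<½ε (N , λ m N≤m →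
       ≡.subst (ℚ._≤ seq x m) (≡.sym (ℚ.+-identityˡ (½ ℚ.* ε)))
         (halve (seq x m) (ℚ.≤-trans (ℚ.<⇒≤ ε<xₙ) (∣p-q∣≤r⇒p≤q+r (close n m N≤n N≤m))))))
  where
  0<½ε : 0ℚ ℚ.< ½ ℚ.* ε
  0<½ε = 0<p*q (ℚ.positive⁻¹ ½) 0<ε
  halve : ∀ y → ε ℚ.≤ y ℚ.+ ½ ℚ.* ε → ½ ℚ.* ε ℚ.≤ y
  halve y le = ≡.subst₂ ℚ._≤_
    (≡.trans (cong (ℚ._- ½ ℚ.* ε) (≡.sym (½+½ ε)))
      (solve 1 (λ h → h :+ h :- h := h) ≡.refl (½ ℚ.* ε)))
    (solve 2 (λ y h → y :+ h :- h := y) ≡.refl y (½ ℚ.* ε))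
    (ℚ.+-monoˡ-≤ (ℚ.- (½ ℚ.* ε)) le)

eventually-positivePart⁴ : ∀ {x} (d : Dec (0ℝ < x)) ε → 0ℚ ℚ.< ε →
  Eventually (λ n → PositivePart⁴ ε (seq x n) (seq (if does d then x ^ 4 else 0ℝ) n))
eventually-positivePart⁴ {x} (yes (mk< g 0<g (N , gap))) ε 0<ε = N , λ n N≤n →
  inj₁ (ℚ.≤-trans (ℚ.<⇒≤ 0<g) (≡.subst (ℚ._≤ seq x n) (ℚ.+-identityˡ g) (gap n N≤n)) , ≡.refl)
eventually-positivePart⁴ (no x≯0) ε 0<ε =
  eventually-map (λ n xₙ≤ε → inj₂ (xₙ≤ε , ≡.refl)) (≮0⇒eventually≤ x≯0 ε 0<ε)

sum-linear : ∀ {m} c (f g : Vector ℚ m) →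
  sumℚ (λ j → c ℚ.* f j ℚ.- g j) ≡ c ℚ.* sumℚ f ℚ.- sumℚ g
sum-linear {ℕ.zero}  c f g = solve 1 (λ c → con 0ℚ := c :* con 0ℚ :- con 0ℚ) ≡.refl c
sum-linear {ℕ.suc m} c f g = ≡.trans
  (cong (c ℚ.* f zero ℚ.- g zero ℚ.+_) (sum-linear c (f ∘ suc) (g ∘ suc)))
  (solve 5 (λ c a b s t → c :* a :- b :+ (c :* s :- t) := c :* (a :+ s) :- (b :+ t)) ≡.refl
    c (f zero) (g zero) (sumℚ (f ∘ suc)) (sumℚ (g ∘ suc)))

-- The positive 4-energy of a graph whose looped adjacency matrix is a blow-up

module Certificate {n m} (class : Fin n → Fin m) (size : Fin m → ℤ)
  (size≡ : ∀ a → size a ≡ sumℤ λ i → indicator (class i == a))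
  (M : Fin m → Fin m → Bool) where

  open Blowup class size size≡ M

  -- R bounds ∣λ∣ and η bounds the error of S(κ)² ≈ D ∣λ∣.  The approximating sequences
  -- satisfy the trace identities only up to 1, which accounts for the
  -- summands + 1.
  record IsCertificate (D η R : ℤ) (S : Poly) (e : ℤ) : Set where
    field
      0<D           : + 0 ℤ.< D
      0<η           : + 0 ℤ.< η
      0≤R           : + 0 ℤ.≤ R
      moment-t²     : moment powerTrace (square X-1) ℤ.+ + 1 ℤ.≤ R ℤ.* R
      moment-defect : moment powerTrace (square (defect D S)) ℤ.+ + 1 ℤ.≤ (η ℤ.* η) ℤ.* (η ℤ.* η)
      -- Three errors are added: `n` terms each off by at most `R³ * 2 η`, the slack 1, and the
      -- distance of the trace from `2 D e`. The factor 5 makes their sum at most 1/5 after division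
      -- by `2 D`.
      moment-energy : + 5 ℤ.* (+ n ℤ.* (R ℤ.* (R ℤ.* R) ℤ.* (η ℤ.+ η)) ℤ.+ + 1
                        ℤ.+ + ℤ.∣ moment powerTrace (energy D S) ℤ.- (D ℤ.+ D) ℤ.* e ∣) ℤ.≤ D ℤ.+ D

  module _ (G : Graph n) (looped : ∀ a → M a a ≡ true)
           (quotient : ∀ i j → adjacent G i j ≡ M (class i) (class j) ∧ not (i == j))
           (spectrum : Spectrum (adjacencyMatrix G)) where

    open Spectrum spectrum

    private
      κ : Fin n → ℝ
      κ j = eigenvalue j + 1ℝ

    blowup≃A+1 : ∀ i j → blowup i j ≃ adjacencyMatrix G i j + 1ᴹ i j
    blowup≃A+1 i j with i Fin.≟ j | quotient i j
    ... | yes ≡.refl | q rewrite q | looped (class i) = ≗⇒≃ λ _ → ≡.refl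
    ... | no _       | q rewrite q with M (class i) (class j)
    ...   | true  = ≗⇒≃ λ _ → ≡.refl
    ...   | false = ≗⇒≃ λ _ → ≡.refl

    blowup-eigen : ∀ j → blowup *ᵥ eigenvector j ≋ κ j ·ᵥ eigenvector j
    blowup-eigen j i = begin
      sum (λ l → blowup i l * x l)
        ≈⟨ sum-cong (λ l → ≃-trans (*-congʳ (blowup≃A+1 i l))
             (distribʳ (x l) (adjacencyMatrix G i l) (1ᴹ i l))) ⟩
      sum (λ l → adjacencyMatrix G i l * x l + 1ᴹ i l * x l)
        ≈⟨ ∑-distrib-+ (λ l → adjacencyMatrix G i l * x l) (λ l → 1ᴹ i l * x l) ⟩
      sum (λ l → adjacencyMatrix G i l * x l) + sum (λ l → 1ᴹ i l * x l)
        ≈⟨ +-cong (isEigen j i) (≃-trans (sum-1ᴹ i x) (≃-sym (*-identityˡ (x i)))) ⟩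
      eigenvalue j * x i + 1ℝ * x i
        ≈⟨ distribʳ (x i) (eigenvalue j) 1ℝ ⟨
      κ j * x i ∎
      where
      open ≃-Reasoning
      x : Vector ℝ n
      x = eigenvector j

    -- The given eigenvectors belong to `κ j ^ k` under the `k`-th power of `blowup`, so the power
    -- sums of `κ` are the integers `powerTrace k`; `moment-sum` is used with all weights 1.
    sum-evalℝ : ∀ p → sum (λ j → evalℝ p (κ j)) ≃ ι (moment powerTrace p)
    sum-evalℝ p = ≃-trans
      (sum-cong λ j → ≃-sym (*-identityˡ (evalℝ p (κ j))))
      (moment-sum κ p (λ _ → 1ℝ) powerTrace λ k → ≃-trans
        (sum-cong λ j → *-identityˡ (κ j ^ k))
        (≃-trans (≃-sym (trace-eigenvalues isBasis (blowup ^ᴹ k) (λ j → κ j ^ k)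
                           (λ j → ^ᴹ-eigen (blowup-eigen j) k)))
                 (trace-blowup k)))

    eventually-sum : ∀ p → Eventually λ N →
      ∣ sumℚ (λ j → ⟦ p ⟧ (seq (κ j) N)) ℚ.- fromℤ (moment powerTrace p) ∣ ℚ.≤ 1ℚ
    eventually-sum p = eventually-map
      (λ N → ≡.subst (λ s → ∣ s ℚ.- fromℤ (moment powerTrace p) ∣ ℚ.≤ 1ℚ)
        (≡.trans (seq-sum (λ j → evalℝ p (κ j)) N) (sumℚ-cong λ j → seq-evalℝ p (κ j) N)))
      (≃⇒null (sum-evalℝ p) 1ℚ (ℚ.positive⁻¹ 1ℚ))

    -- A square is at most the sum of all the squares. For `X-1` this bounds the terms of every
    -- eigenvalue by `R` in absolute value, and for `defect D S` it bounds every approximation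
    -- error.
    eventually-term≤ : ∀ p B → moment powerTrace (square p) ℤ.+ + 1 ℤ.≤ B →
      Eventually λ N → ∀ j → ⟦ p ⟧ (seq (κ j) N) ℚ.* ⟦ p ⟧ (seq (κ j) N) ℚ.≤ fromℤ B
    eventually-term≤ p B moment<B = eventually-map
      (λ N close j → begin
        ⟦ p ⟧ (seq (κ j) N) ℚ.* ⟦ p ⟧ (seq (κ j) N)
          ≡⟨ ⟦⊗⟧ p p (seq (κ j) N) ⟨
        ⟦ square p ⟧ (seq (κ j) N)
          ≤⟨ term≤sum (λ j → ⟦ square p ⟧ (seq (κ j) N))
               (λ j → ≡.subst (0ℚ ℚ.≤_) (≡.sym (⟦⊗⟧ p p (seq (κ j) N))) (0≤p² (⟦ p ⟧ (seq (κ j) N)))) j ⟩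
        sumℚ (λ j → ⟦ square p ⟧ (seq (κ j) N))
          ≤⟨ ∣p-q∣≤r⇒p≤q+r close ⟩
        fromℤ (moment powerTrace (square p)) ℚ.+ 1ℚ
          ≡⟨ fromℤ-+ (moment powerTrace (square p)) (+ 1) ⟨
        fromℤ (moment powerTrace (square p) ℤ.+ + 1)
          ≤⟨ fromℤ-mono-≤ moment<B ⟩
        fromℤ B ∎)
      (eventually-sum (square p))
      where open ℚ.≤-Reasoning

    eventually-𝓔₄⁺ : ∀ {D η R S e} → IsCertificate D η R S e →
      Eventually λ N → ∣ seq (𝓔₄⁺ G spectrum) N ℚ.- fromℤ e ∣ ℚ.≤ + 1 / 5
    eventually-𝓔₄⁺ {D} {η} {R} {S} {e} cert = eventually-zip
      (λ N p q → estimate N (proj₁ p) (proj₂ p) (proj₁ q) (proj₂ q))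
      (eventually-zip (λ _ → _,_)
        (eventually-term≤ X-1 (R ℤ.* R) moment-t²)
        (eventually-term≤ (defect D S) ((η ℤ.* η) ℤ.* (η ℤ.* η)) moment-defect))
      (eventually-zip (λ _ → _,_)
        (eventually-sum (energy D S))
        (eventually-∀Fin λ j → eventually-positivePart⁴ (positive? j) ε 0<ε))
      where
      open IsCertificate cert
      open ℚ.≤-Reasoning

      d h r : ℚ
      d = fromℤ D
      h = fromℤ η
      r = fromℤ R

      0<d : 0ℚ ℚ.< d
      0<d = fromℤ-mono-< 0<D
      0<h : 0ℚ ℚ.< h
      0<h = fromℤ-mono-< 0<η
      instance
        d-positive : ℚ.Positive d
        d-positive = ℚ.positive 0<d
        d-nonZero : ℚ.NonZero d
        d-nonZero = ℚ.pos⇒nonZero d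

      -- Chosen so that `D (ε + ε) = η`, the allowance of `positivePart⁴-close` for slightly
      -- positive terms of eigenvalues that are not positive.
      ε : ℚ
      ε = ½ ℚ.* (h ℚ.* ℚ.1/ d)
      0<ε : 0ℚ ℚ.< ε
      0<ε = 0<p*q (ℚ.positive⁻¹ ½) (0<p*q 0<h (ℚ.positive⁻¹ (ℚ.1/ d) {{ℚ.1/pos⇒pos d}}))
      d[ε+ε]≡h : d ℚ.* (ε ℚ.+ ε) ≡ h
      d[ε+ε]≡h = ≡.trans (cong (d ℚ.*_) (½+½ (h ℚ.* ℚ.1/ d)))
        (≡.trans (solve 3 (λ d h i → d :* (h :* i) := h :* (d :* i)) ≡.refl d h (ℚ.1/ d))
          (≡.trans (cong (h ℚ.*_) (ℚ.*-inverseʳ d)) (ℚ.*-identityʳ h)))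

      module _ (N : ℕ) where
        g t w x : Fin n → ℚ
        g j = seq (if does (positive? j) then eigenvalue j ^ 4 else 0ℝ) N
        t j = seq (eigenvalue j) N
        x j = seq (κ j) N
        w j = ⟦ square S ⟧ (x j)

        B : ℤ
        B = R ℤ.* (R ℤ.* R) ℤ.* (η ℤ.+ η)
        C : ℤ
        C = moment powerTrace (energy D S)

        fromℤ-B : fromℤ B ≡ r ℚ.* (r ℚ.* r) ℚ.* (h ℚ.+ h)
        fromℤ-B = ≡.trans (fromℤ-* (R ℤ.* (R ℤ.* R)) (η ℤ.+ η))
          (cong₂ ℚ._*_ (≡.trans (fromℤ-* R (R ℤ.* R)) (cong (r ℚ.*_) (fromℤ-* R R))) (fromℤ-+ η η))

        fromℤ-C : ∣ fromℤ C ℚ.- (d ℚ.+ d) ℚ.* fromℤ e ∣ ≡ fromℤ (+ ℤ.∣ C ℤ.- (D ℤ.+ D) ℤ.* e ∣)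
        fromℤ-C = cong ∣_∣ (≡.sym (≡.trans (fromℤ-+ C (ℤ.- ((D ℤ.+ D) ℤ.* e)))
          (cong (fromℤ C ℚ.+_) (≡.trans (fromℤ-neg ((D ℤ.+ D) ℤ.* e))
            (cong ℚ.-_ (≡.trans (fromℤ-* (D ℤ.+ D) e) (cong (ℚ._* fromℤ e) (fromℤ-+ D D))))))))

        estimate :
          (∀ j → ⟦ X-1 ⟧ (x j) ℚ.* ⟦ X-1 ⟧ (x j) ℚ.≤ fromℤ (R ℤ.* R)) →
          (∀ j → ⟦ defect D S ⟧ (x j) ℚ.* ⟦ defect D S ⟧ (x j) ℚ.≤ fromℤ ((η ℤ.* η) ℤ.* (η ℤ.* η))) →
          ∣ sumℚ (λ j → ⟦ energy D S ⟧ (x j)) ℚ.- fromℤ C ∣ ℚ.≤ 1ℚ →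
          (∀ j → PositivePart⁴ ε (t j) (g j)) →
          ∣ seq (𝓔₄⁺ G spectrum) N ℚ.- fromℤ e ∣ ℚ.≤ + 1 / 5
        estimate t²≤ defect²≤ sum-energy parts =
          ≡.subst (λ E → ∣ E ℚ.- fromℤ e ∣ ℚ.≤ + 1 / 5)
            (≡.sym (seq-sum (λ j → if does (positive? j) then eigenvalue j ^ 4 else 0ℝ) N))
            (cancel (begin
              ∣ (d ℚ.+ d) ℚ.* sumℚ g ℚ.- (d ℚ.+ d) ℚ.* fromℤ e ∣
                -- The path runs from the scaled energy to the sum of the polynomial `energy`, then
                -- to its trace `C`, then to `2 D e`.
                ≤⟨ ∣p-q∣-trans 2dE (fromℤ C) ((d ℚ.+ d) ℚ.* fromℤ e)
                     (∣p-q∣-trans 2dE (sumℚ (λ j → ⟦ energy D S ⟧ (x j))) (fromℤ C) termwise sum-energy)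
                     (ℚ.≤-reflexive fromℤ-C) ⟩
              fromℤ (+ n ℤ.* B) ℚ.+ 1ℚ ℚ.+ fromℤ (+ ℤ.∣ C ℤ.- (D ℤ.+ D) ℤ.* e ∣)
                ≡⟨ ≡.trans (fromℤ-+ (+ n ℤ.* B ℤ.+ + 1) (+ ℤ.∣ C ℤ.- (D ℤ.+ D) ℤ.* e ∣))
                     (cong (ℚ._+ fromℤ (+ ℤ.∣ C ℤ.- (D ℤ.+ D) ℤ.* e ∣)) (fromℤ-+ (+ n ℤ.* B) (+ 1))) ⟨
              fromℤ total ∎))
          where
          2dE : ℚ
          2dE = (d ℚ.+ d) ℚ.* sumℚ g

          total : ℤ
          total = + n ℤ.* B ℤ.+ + 1 ℤ.+ + ℤ.∣ C ℤ.- (D ℤ.+ D) ℤ.* e ∣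

          termwise : ∣ (d ℚ.+ d) ℚ.* sumℚ g ℚ.- sumℚ (λ j → ⟦ energy D S ⟧ (x j)) ∣ ℚ.≤ fromℤ (+ n ℤ.* B)
          termwise = ≡.subst₂ ℚ._≤_ (cong ∣_∣ split) (sum-const n B)
            (∣sum∣≤ (λ j → (d ℚ.+ d) ℚ.* g j ℚ.- ⟦ energy D S ⟧ (x j)) λ j →
              ≡.subst₂ ℚ._≤_
                (cong (λ s → ∣ (d ℚ.+ d) ℚ.* g j ℚ.- s ∣) (≡.sym (⟦energy⟧ D S (⟦X-1⟧ (t j)))))
                (≡.sym fromℤ-B)
                (positivePart⁴-close (t j) (w j) (g j) (ℚ.<⇒≤ 0<d) (ℚ.<⇒≤ 0<h) (fromℤ-mono-≤ 0≤R)
                  (ℚ.≤-reflexive d[ε+ε]≡h)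
                  (≡.subst (0ℚ ℚ.≤_) (≡.sym (⟦⊗⟧ S S (x j))) (0≤p² (⟦ S ⟧ (x j))))
                  (≡.subst₂ ℚ._≤_ (cong₂ ℚ._*_ (⟦X-1⟧ (t j)) (⟦X-1⟧ (t j))) (fromℤ-* R R) (t²≤ j))
                  (≡.subst₂ ℚ._≤_
                    (cong₂ ℚ._*_ (⟦defect⟧ D S (⟦X-1⟧ (t j))) (⟦defect⟧ D S (⟦X-1⟧ (t j))))
                    (≡.trans (fromℤ-* (η ℤ.* η) (η ℤ.* η)) (cong₂ ℚ._*_ (fromℤ-* η η) (fromℤ-* η η)))
                    (defect²≤ j))
                  (parts j)))
            where
            split : sumℚ (λ j → (d ℚ.+ d) ℚ.* g j ℚ.- ⟦ energy D S ⟧ (x j))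
                    ≡ (d ℚ.+ d) ℚ.* sumℚ g ℚ.- sumℚ (λ j → ⟦ energy D S ⟧ (x j))
            split = sum-linear (d ℚ.+ d) g (λ j → ⟦ energy D S ⟧ (x j))

          cancel : ∣ (d ℚ.+ d) ℚ.* sumℚ g ℚ.- (d ℚ.+ d) ℚ.* fromℤ e ∣ ℚ.≤ fromℤ total →
                   ∣ sumℚ g ℚ.- fromℤ e ∣ ℚ.≤ + 1 / 5
          cancel close = ℚ.*-cancelˡ-≤-pos (d ℚ.+ d) {{ℚ.pos+pos⇒pos d d}} (ℚ.*-cancelˡ-≤-pos (fromℤ (+ 5)) (begin
            fromℤ (+ 5) ℚ.* ((d ℚ.+ d) ℚ.* ∣ sumℚ g ℚ.- fromℤ e ∣)
              ≡⟨ cong (fromℤ (+ 5) ℚ.*_) (≡.trans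
                   (cong (ℚ._* ∣ sumℚ g ℚ.- fromℤ e ∣)
                     (≡.sym (ℚ.0≤p⇒∣p∣≡p (ℚ.+-mono-≤ (ℚ.<⇒≤ 0<d) (ℚ.<⇒≤ 0<d)))))
                   (≡.trans (≡.sym (ℚ.∣p*q∣≡∣p∣*∣q∣ (d ℚ.+ d) (sumℚ g ℚ.- fromℤ e)))
                     (cong ∣_∣ (solve 3 (λ d a b → d :* (a :- b) := d :* a :- d :* b) ≡.refl
                       (d ℚ.+ d) (sumℚ g) (fromℤ e))))) ⟩
            fromℤ (+ 5) ℚ.* ∣ (d ℚ.+ d) ℚ.* sumℚ g ℚ.- (d ℚ.+ d) ℚ.* fromℤ e ∣
              ≤⟨ ℚ.*-monoˡ-≤-nonNeg (fromℤ (+ 5)) close ⟩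
            fromℤ (+ 5) ℚ.* fromℤ total
              ≡⟨ fromℤ-* (+ 5) total ⟨
            fromℤ (+ 5 ℤ.* total)
              ≤⟨ fromℤ-mono-≤ moment-energy ⟩
            fromℤ (D ℤ.+ D)
              ≡⟨ fromℤ-+ D D ⟩
            d ℚ.+ d
              ≡⟨ ℚ.*-identityʳ (d ℚ.+ d) ⟨
            (d ℚ.+ d) ℚ.* (fromℤ (+ 5) ℚ.* (+ 1 / 5))
              ≡⟨ solve 3 (λ d a b → d :* (a :* b) := a :* (d :* b)) ≡.refl (d ℚ.+ d) (fromℤ (+ 5)) (+ 1 / 5) ⟩
            fromℤ (+ 5) ℚ.* ((d ℚ.+ d) ℚ.* (+ 1 / 5)) ∎))

-- The graphs J₀ and J₁

-- Classes `0F` to `3F` are the cliques `C₁` to `C₄`; `4F` and `5F` are the singletons of `u` and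
-- `v`.
class : Fin 38 → Fin 6
class i = join 4 2 (Sum.map₁ proj₁ (vertex i))

classSize : Fin 6 → ℤ
classSize 0F = + 9
classSize 1F = + 9
classSize 2F = + 9
classSize 3F = + 9
classSize 4F = + 1
classSize 5F = + 1

classSize≡ : ∀ a → classSize a ≡ sumℤ λ i → indicator (class i == a)
classSize≡ 0F = ≡.refl
classSize≡ 1F = ≡.refl
classSize≡ 2F = ≡.refl
classSize≡ 3F = ≡.refl
classSize≡ 4F = ≡.refl
classSize≡ 5F = ≡.refl

module Quotient (uv : Bool) where

  edge : Fin 6 → Fin 6 → Bool
  edge 0F 1F = true
  edge 1F 2F = true
  edge 2F 3F = true
  edge 4F 0F = true
  edge 5F 3F = true
  edge 4F 5F = uv
  edge _  _  = false

  quotient : Fin 6 → Fin 6 → Bool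
  quotient a b = (a == b) ∨ (edge a b ∨ edge b a)

  looped : ∀ a → quotient a a ≡ true
  looped a = cong (_∨ (edge a a ∨ edge a a)) (==-refl a)

  open Certificate class classSize classSize≡ quotient public

module Q₀ = Quotient false
module Q₁ = Quotient true

quotient-J₀ : ∀ i j → adjacent J₀ i j ≡ Q₀.quotient (class i) (class j) ∧ not (i == j)
quotient-J₀ = toWitness {a? = Fin.all? λ i → Fin.all? λ j → _ Bool.≟ _} tt

quotient-J₁ : ∀ i j → adjacent J₁ i j ≡ Q₁.quotient (class i) (class j) ∧ not (i == j)
quotient-J₁ = toWitness {a? = Fin.all? λ i → Fin.all? λ j → _ Bool.≟ _} tt

-- Numerical certificates for the two graphs

D η R : ℤ
-- A perfect square: the constant coefficients below are its root, so the defect vanishes exactly at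
-- `κ = 0`, an eigenvalue of multiplicity at least 32 because `K` has rank at most 6.
D = + (10 ℕ.^ 60)
-- Large enough to absorb the rounding of the coefficients, yet `5 * 38 * 29³ * 2 η` is about 9.3 ·
-- 10⁵⁷, far below `2 D`.
η = + (10 ℕ.^ 51)
-- The sum of the `λ²` is twice the number of edges, 810 for `J₀` and 812 for `J₁`; 29² = 841 is the
-- first square exceeding these.
R = + 29

-- Interpolates √(D ∣κ - 1∣) at the eigenvalues κ of K, with rounded coefficients.
sqrt₀ sqrt₁ : Poly
sqrt₀ = + 1000000000000000000000000000000
  ∷ ℤ.- + 619723617307513701147108601370
  ∷ ℤ.- + 228209629234640033463485844099
  ∷ + 66974584458002834677903596519
  ∷ + 7564203122699272699213934238
  ∷ ℤ.- + 1234042383979952276867194843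
  ∷ + 34413758825870577683858121 ∷ []
-- Degree 4 suffices: `K` has five distinct eigenvalues for `J₁`, namely 0, 15, -6 and the roots of
-- `κ² - 29 κ + 126`. For `J₀` it has seven, hence degree 6 above.
sqrt₁ = + 1000000000000000000000000000000
  ∷ + 79063578454186387431535155962
  ∷ + 37773811868469837688528315234
  ∷ ℤ.- + 3101940131984707991707989316
  ∷ + 69642350321063142048519791 ∷ []

-- Every field compares closed integers and is settled by evaluation. The squared defect has degree
-- 48 in `κ`, so traces up to the 48th power of `K` enter.
certificate₀ : Q₀.IsCertificate D η R sqrt₀ (+ 303301)
certificate₀ = record
  { 0<D = ℤ.+<+ (ℕ.<ᵇ⇒< 0 _ tt)
  ; 0<η = ℤ.+<+ (ℕ.<ᵇ⇒< 0 _ tt)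
  ; 0≤R = ℤ.≤ᵇ⇒≤ _
  ; moment-t² = ℤ.≤ᵇ⇒≤ _
  ; moment-defect = ℤ.≤ᵇ⇒≤ _
  ; moment-energy = ℤ.≤ᵇ⇒≤ _
  }

certificate₁ : Q₁.IsCertificate D η R sqrt₁ (+ 303297)
certificate₁ = record
  { 0<D = ℤ.+<+ (ℕ.<ᵇ⇒< 0 _ tt)
  ; 0<η = ℤ.+<+ (ℕ.<ᵇ⇒< 0 _ tt)
  ; 0≤R = ℤ.≤ᵇ⇒≤ _
  ; moment-t² = ℤ.≤ᵇ⇒≤ _
  ; moment-defect = ℤ.≤ᵇ⇒≤ _
  ; moment-energy = ℤ.≤ᵇ⇒≤ _
  }

-- Comparison of the two energies

mainTheorem4 : (S₀ : Spectrum (adjacencyMatrix J₀)) (S₁ : Spectrum (adjacencyMatrix J₁)) →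
    (𝓔₄⁺ J₁ S₁ - 𝓔₄⁺ J₀ S₀ < fromℚ (-ℚ (+ 1281106782111 / 500000000000))) ×
    (fromℚ (-ℚ (+ 1281106782111 / 500000000000)) < 0ℝ)
mainTheorem4 S₀ S₁ =
  -- The difference of the energies is eventually at most -4 + 2/5 = -3.6, more than 1 below the
  -- bound -2.562..., so 1 serves as the gap. It also separates the bound from 0.
  mk< 1ℚ (ℚ.positive⁻¹ 1ℚ) gap ,
  mk< 1ℚ (ℚ.positive⁻¹ 1ℚ) (always λ _ → ℚ.≤ᵇ⇒≤ _)
  where
  bound : ℚ
  bound = -ℚ (+ 1281106782111 / 500000000000)

  E₀ E₁ : ℕ → ℚ
  E₀ = seq (𝓔₄⁺ J₀ S₀)
  E₁ = seq (𝓔₄⁺ J₁ S₁)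

  gap : Eventually λ n → E₁ n ℚ.- E₀ n ℚ.+ 1ℚ ℚ.≤ bound
  gap = eventually-zip
    (λ n E₀≈ E₁≈ → begin
      E₁ n ℚ.- E₀ n ℚ.+ 1ℚ
        ≤⟨ ℚ.+-monoˡ-≤ 1ℚ (ℚ.+-mono-≤
             (∣p-q∣≤r⇒p≤q+r {E₁ n} {fromℤ (+ 303297)} E₁≈)
             (ℚ.neg-antimono-≤ (lower {E₀ n} {fromℤ (+ 303301)} E₀≈))) ⟩
      fromℤ (+ 303297) ℚ.+ (+ 1 / 5) ℚ.- (fromℤ (+ 303301) ℚ.- (+ 1 / 5)) ℚ.+ 1ℚ
        ≤⟨ ℚ.≤ᵇ⇒≤ _ ⟩
      bound ∎)
    (Q₀.eventually-𝓔₄⁺ J₀ Q₀.looped quotient-J₀ S₀ certificate₀)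
    (Q₁.eventually-𝓔₄⁺ J₁ Q₁.looped quotient-J₁ S₁ certificate₁)
    where
    open ℚ.≤-Reasoning
    lower : ∀ {p q r} → ∣ p ℚ.- q ∣ ℚ.≤ r → q ℚ.- r ℚ.≤ p
    lower {p} {q} {r} p≈q = ≡.subst (q ℚ.- r ℚ.≤_)
      (solve 2 (λ p r → p :+ r :- r := p) ≡.refl p r)
      (ℚ.+-monoˡ-≤ (ℚ.- r) (∣p-q∣≤r⇒p≤q+r {q} {p} (≡.subst (ℚ._≤ r) (∣p-q∣≡∣q-p∣ p q) p≈q)))
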